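{- Let $k,n\ge1$ be integers and consider the linear program (LP) of a bin packing instance with $n$ items whose sizes satisfy $s_1,\dots,s_n\in(\tfrac1{k+1},1]$. Let $OPT$ and $OPT_f$ be the integer and fractional optimum values of (LP). Then $$OPT\le OPT_f+\Big(1+\frac1k\Big)D^{\mathrm{mon}}_k(n).$$
   Context: Bin packing LP: for item sizes $s=(s_1,\dots,s_n)\in[0,1]^n$, let $\mathcal P=\{p\in\{0,1\}^n : s^Tp\le 1\}$. The linear program (LP) is $$\min \sum_{p\in\mathcal P} x_p \quad\text{s.t.}\quad \sum_{p\in\mathcal P} p\, x_p \ge \mathbf 1,\qquad x_p\ge 0 \ \ \forall p\in\mathcal P,$$ with $\mathbf 1$ the all-ones vector. $OPT_f$ is its optimum value and $OPT$ is the minimum of the same objective over integral feasible $x$. Monotone matrices: a matrix $A$ with $m$ rows and $n$ columns is $k$-monotone if $A\in\{0,1,\dots,k\}^{m\times n}$ and $A_{1j}\le A_{2j}\le\dots\le A_{mj}$ for every column $j$. The linear discrepancy of $A\in\mathbb R^{m\times n}$ is $$\mathrm{lindisc}(A)=\max_{y\in[0,1]^n}\ \min_{x\in\{0,1\}^n}\|Ax-Ay\|_\infty .$$ $D^{\mathrm{mon}}_k(n)$ is the maximum of $\mathrm{lindisc}(A)$ over all $k$-monotone matrices $A\in\mathbb Z^{m\times n}$ with $n$ columns and any number $m$ of rows. -}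

module Defs where

open import Algebra.Bundles using (CommutativeRing)
open import Data.Bool.Base using (Bool; true; false; if_then_else_)
open import Data.Fin.Base as Fin using (Fin)
open import Data.Integer.Base using (ℤ; +_; -[1+_])
open import Data.List.Base as List using (List; []; _∷_; _++_)
open import Data.Nat.Base as ℕ using (ℕ; zero; suc)
open import Data.Product.Base using (_×_; _,_; ∃; ∃-syntax)
open import Data.Vec.Base as Vec using (Vec; []; _∷_)
open import Data.Vec.Functional using (Vector)
open import Level using (0ℓ) renaming (suc to lsuc)
open import Relation.Binary.Bundles using (DecTotalOrder)
open import Relation.Binary.Core using (Rel)
open import Relation.Binary.Structures using (IsDecTotalOrder)
open import Relation.Nullary.Negation.Core using (¬_)
open import Relation.Unary using (Pred)
import Algebra.Construct.NaturalChoice.Max as Max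
import Algebra.Definitions.RawMonoid as RawMonoidDefinitions
import Data.List.Extrema as Extrema
import Relation.Binary.Construct.NonStrictToStrict as NonStrictToStrict

module _ {A : Set} (_≤_ : Rel A 0ℓ) where

  UpperBound LowerBound : Pred A 0ℓ → Pred A 0ℓ
  UpperBound P b = ∀ v → P v → v ≤ b
  LowerBound P b = ∀ v → P v → b ≤ v

  IsSupremum IsInfimum IsMaximum IsMinimum : Pred A 0ℓ → Pred A 0ℓ
  IsSupremum P b = UpperBound P b × LowerBound (UpperBound P) b
  IsInfimum  P b = LowerBound P b × UpperBound (LowerBound P) b
  IsMaximum  P b = P b × UpperBound P b
  IsMinimum  P b = P b × LowerBound P b

-- The real numbers, axiomatised as a Dedekind-complete ordered field with
-- classical (decidable) order.  Both _⁻¹ and sup are total functions; their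
-- values at 0#, respectively at empty or unbounded sets, are unspecified.
record CompleteOrderedField : Set (lsuc 0ℓ) where
  infix  8 _⁻¹
  infix  4 _≤_
  field
    commutativeRing : CommutativeRing 0ℓ 0ℓ

  open CommutativeRing commutativeRing public

  field
    0≉1             : ¬ (0# ≈ 1#)
    _⁻¹             : Carrier → Carrier
    *-inverseʳ      : ∀ x → ¬ (x ≈ 0#) → x * x ⁻¹ ≈ 1#
    _≤_             : Rel Carrier 0ℓ
    isDecTotalOrder : IsDecTotalOrder _≈_ _≤_
    +-monoˡ-≤       : ∀ z {x y} → x ≤ y → x + z ≤ y + z
    *-nonNeg        : ∀ {x y} → 0# ≤ x → 0# ≤ y → 0# ≤ x * y
    sup             : Pred Carrier 0ℓ → Carrier
    sup-isSupremum  : ∀ P → ∃ P → ∃ (UpperBound _≤_ P) → IsSupremum _≤_ P (sup P)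

  decTotalOrder : DecTotalOrder 0ℓ 0ℓ 0ℓ
  decTotalOrder = record { isDecTotalOrder = isDecTotalOrder }

  open DecTotalOrder decTotalOrder public
    using (totalOrder; _≤?_; antisym)
    renaming (refl to ≤-refl; reflexive to ≤-reflexive; trans to ≤-trans; total to ≤-total)
  open NonStrictToStrict _≈_ _≤_ public using (_<_)
  open Max totalOrder public using (_⊔_)
  open Extrema totalOrder public using (max; min)
  open RawMonoidDefinitions +-rawMonoid public using (sum) renaming (_×_ to _×ₙ_)

  fromℕ : ℕ → Carrier
  fromℕ n = n ×ₙ 1#

  fromℤ : ℤ → Carrier
  fromℤ (+ n)    = fromℕ n
  fromℤ -[1+ n ] = - fromℕ (suc n)

  ∣_∣ : Carrier → Carrier
  ∣ x ∣ = x ⊔ (- x)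

  inf : Pred Carrier 0ℓ → Carrier
  inf P = sup (LowerBound _≤_ P)

  inf-isInfimum : ∀ P → ∃ P → ∃ (LowerBound _≤_ P) → IsInfimum _≤_ P (inf P)
  inf-isInfimum P (v , Pv) bounded
    with ub , least ← sup-isSupremum (LowerBound _≤_ P) bounded (v , λ b lb → lb v Pv)
    = (λ w Pw → least w (λ b lb → lb w Pw)) , ub

  -- Whenever a set has a maximum (minimum), sup (inf) is that maximum (minimum).
  maximum⇒≈sup : ∀ {P v} → IsMaximum _≤_ P v → v ≈ sup P
  maximum⇒≈sup {P} {v} (Pv , ub)
    with ub′ , least ← sup-isSupremum P (v , Pv) (v , ub)
    = antisym (ub′ v Pv) (least v ub)

  minimum⇒≈inf : ∀ {P v} → IsMinimum _≤_ P v → v ≈ inf P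
  minimum⇒≈inf {P} {v} (Pv , lb)
    with lb′ , greatest ← inf-isInfimum P (v , Pv) (v , lb)
    = antisym (greatest v lb) (lb′ v Pv)

allBoolVecs : ∀ n → List (Vec Bool n)
allBoolVecs zero    = [] ∷ []
allBoolVecs (suc n) =
  List.map (false ∷_) (allBoolVecs n) ++ List.map (true ∷_) (allBoolVecs n)

module _ (R : CompleteOrderedField) where
  open CompleteOrderedField R

  bits : ∀ {n} → Vec Bool n → Vector Carrier n
  bits p i = if Vec.lookup p i then 1# else 0#

  module BinPacking {n : ℕ} (s : Vector Carrier n) where

    size : Vec Bool n → Carrier
    size p = sum (λ i → s i * bits p i)

    -- The set 𝒫, listed without repetition.
    patterns : List (Vec Bool n)
    patterns = List.filter (λ p → size p ≤? 1#) (allBoolVecs n)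

    -- Vectors (x_p) indexed by 𝒫, via the position of p in the list.
    PatternVector : Set
    PatternVector = Vector Carrier (List.length patterns)

    objective : PatternVector → Carrier
    objective x = sum x

    Feasible : Pred PatternVector 0ℓ
    Feasible x =
      (∀ i → 1# ≤ sum (λ q → bits (List.lookup patterns q) i * x q)) ×
      (∀ q → 0# ≤ x q)

    Integral : Pred PatternVector 0ℓ
    Integral x = ∀ q → ∃[ z ] x q ≈ fromℤ z

    OPTf : Carrier
    OPTf = inf (λ v → ∃[ x ] Feasible x × v ≈ objective x)

    OPT : Carrier
    OPT = inf (λ v → ∃[ x ] (Feasible x × Integral x) × v ≈ objective x)

  open BinPacking public using (OPT; OPTf)

  Matrix : Set → ℕ → ℕ → Set
  Matrix A m n = Fin m → Fin n → A

  _*ᵥ_ : ∀ {m n} → Matrix Carrier m n → Vector Carrier n → Vector Carrier m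
  (A *ᵥ v) i = sum (λ j → A i j * v j)

  ‖_‖∞ : ∀ {m} → Vector Carrier m → Carrier
  ‖ v ‖∞ = max 0# (List.tabulate (λ i → ∣ v i ∣))

  -- min over x ∈ {0,1}ⁿ of ‖ A x − A y ‖∞; the first argument of min only
  -- makes the (nonempty) minimum total and is itself one of the values.
  roundingError : ∀ {m n} → Matrix Carrier m n → Vector Carrier n → Carrier
  roundingError {n = n} A y =
    min (error (Vec.replicate n false)) (List.map error (allBoolVecs n))
    where
    error : Vec Bool n → Carrier
    error x = ‖ (λ i → (A *ᵥ bits x) i - (A *ᵥ y) i) ‖∞

  lindisc : ∀ {m n} → Matrix Carrier m n → Carrier
  lindisc A = sup (λ v → ∃[ y ] (∀ j → 0# ≤ y j × y j ≤ 1#) × v ≈ roundingError A y)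

  record Monotone (k : ℕ) {m n : ℕ} (A : Matrix ℕ m n) : Set where
    field
      bounded  : ∀ i j → A i j ℕ.≤ k
      monotone : ∀ {i i′} j → i Fin.≤ i′ → A i j ℕ.≤ A i′ j

  Dmon : ℕ → ℕ → Carrier
  Dmon k n =
    sup (λ v → ∃[ m ] ∃[ A ] Monotone k {m} {n} A × v ≈ lindisc (λ i j → fromℕ (A i j)))

{-# OPTIONS --safe #-}
module Submission where

-- Sort the items by decreasing size.  As at most n of the columns are linearly
-- independent, any LP solution can be reduced to n patterns, with weights w in
-- [0,1].  Consider the matrix whose rows count, for each pattern and each t ≤ n,
-- the members among the t largest items, followed by a constant row k; it is
-- k-monotone because each pattern has at most k items.  Rounding w to a 0/1
-- vector x with error at most D in every row, the chosen patterns number at most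
-- Σ w + D / k and offer at least t - D slots for the t largest items.  Placing
-- items greedily into slots of items at least as large, all but at most D items
-- find a slot; each of the others receives a bin of its own.

open import Defs
open import Data.Bool.Base using (Bool; true; false; if_then_else_)
open import Data.Fin.Base as Fin using (Fin; zero; suc; punchIn; punchOut)
open import Data.Fin.Properties as Fin using (any?; punchIn-punchOut)
open import Data.Integer.Base using (+_)
open import Data.List.Base as List using (List; []; _∷_; allFin; take; length)
open import Data.List.Membership.Propositional using (_∈_)
open import Data.List.Membership.Propositional.Properties
  using (∈-++⁺ˡ; ∈-++⁺ʳ; ∈-allFin; ∈-filter⁺; ∈-lookup; ∈-map⁺; ∈-map⁻; ∈-tabulate⁺)
open import Data.List.Properties using (length-map; length-tabulate; length-take; take-[])
open import Data.List.Relation.Binary.Permutation.Propositional as Perm using (_↭_)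
import Data.List.Relation.Binary.Permutation.Propositional.Properties as Perm
open import Data.List.Relation.Unary.All as All using (All; []; _∷_)
import Data.List.Relation.Unary.All.Properties as All
open import Data.List.Relation.Unary.AllPairs using (AllPairs; []; _∷_)
open import Data.List.Relation.Unary.Any as Any using (Any; here; there)
import Data.List.Relation.Unary.Any.Properties as Any
import Data.List.Relation.Unary.Linked.Properties as Linked
open import Data.Nat.Base as ℕ using (ℕ; zero; suc; s≤s; z≤n)
import Data.Nat.Properties as ℕ
open import Data.Product.Base using (_×_; _,_; proj₁; proj₂; ∃-syntax; Σ-syntax)
open import Data.Sum.Base using (_⊎_; inj₁; inj₂; [_,_]′)
open import Data.Vec.Base as Vec using (Vec; []; _∷_; _[_]≔_)
open import Data.Vec.Functional as Vector using (Vector)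
import Data.Vec.Properties as Vec
open import Function.Base using (_∘_; id)
open import Relation.Binary.Bundles using (DecTotalOrder)
open import Relation.Binary.PropositionalEquality as ≡ using (_≡_)
open import Relation.Nullary using (¬_; Dec; yes; no; does; contradiction)
open import Relation.Nullary.Decidable using (¬?; dec-false; dec-true; decidable-stable)
import Algebra.Construct.NaturalChoice.Max as Max
import Algebra.Construct.NaturalChoice.Min as Min
import Algebra.Properties.Ring
import Algebra.Properties.Semiring.Mult
import Algebra.Properties.Semiring.Sum
import Algebra.Solver.Ring.NaturalCoefficients.Default as SemiringSolver
import Data.List.Extrema
import Data.List.Sort
import Relation.Binary.Construct.Flip.EqAndOrd as Flip
import Relation.Binary.Construct.On as On
import Relation.Binary.Reasoning.PartialOrder

-- An item may use any slot planned for an item at least as large, so the Hall condition for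
-- assigning items to slots only involves prefixes of the sorted order. The count of a pattern's
-- members in a prefix grows with the prefix, which is where monotone matrices come from. The value
-- k in the last row is the largest that k-monotonicity allows, so an error of D in that row amounts
-- to only D / k patterns; with the D bins of single items this gives the factor 1 + 1/k. The matrix
-- must have exactly n columns to be compared with `Dmon k n`, hence patterns are padded as well as
-- eliminated. No optimal LP solution is chosen: the bound is proved against every feasible one and
-- then passes to the infimum.

module OrderedField (R : CompleteOrderedField) where
  open CompleteOrderedField R hiding (zero)
  open DecTotalOrder decTotalOrder public using (_≟_; poset)
  open Algebra.Properties.Ring ring
    using (-‿distribˡ-*; -‿distribʳ-*; -‿involutive; -0#≈0#; //-rightDividesˡ; //-rightDividesʳ)
    renaming (⁻¹-anti-homo‿- to -[x-y]≈y-x)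
  open Algebra.Properties.Semiring.Mult semiring using (×-homo-+)
  open Algebra.Properties.Semiring.Sum semiring public
    using (sum-cong-≋; sum-remove; sum-replicate-zero; ∑-distrib-+; *-distribˡ-sum)
  open SemiringSolver commutativeSemiring public using (solve; _:+_; _:*_; _:=_)
  open Relation.Binary.Reasoning.PartialOrder poset public

  -- Arithmetic and order in the field

  +-monoʳ-≤ : ∀ z {x y} → x ≤ y → z + x ≤ z + y
  +-monoʳ-≤ z {x} {y} x≤y = begin
    z + x  ≈⟨ +-comm z x ⟩
    x + z  ≤⟨ +-monoˡ-≤ z x≤y ⟩
    y + z  ≈⟨ +-comm y z ⟩
    z + y  ∎

  +-mono-≤ : ∀ {x y z w} → x ≤ y → z ≤ w → x + z ≤ y + w
  +-mono-≤ {y = y} {z} x≤y z≤w = ≤-trans (+-monoˡ-≤ z x≤y) (+-monoʳ-≤ y z≤w)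

  +-cancelʳ-≤ : ∀ z {x y} → x + z ≤ y + z → x ≤ y
  +-cancelʳ-≤ z {x} {y} le = begin
    x            ≈⟨ //-rightDividesʳ z x ⟨
    (x + z) - z  ≤⟨ +-monoˡ-≤ (- z) le ⟩
    (y + z) - z  ≈⟨ //-rightDividesʳ z y ⟩
    y            ∎

  x-y≤z⇒x≤y+z : ∀ {x y z} → x - y ≤ z → x ≤ y + z
  x-y≤z⇒x≤y+z {x} {y} {z} le = begin
    x            ≈⟨ //-rightDividesˡ y x ⟨
    (x - y) + y  ≤⟨ +-monoˡ-≤ y le ⟩
    z + y        ≈⟨ +-comm z y ⟩
    y + z        ∎

  x≤y+z⇒x-y≤z : ∀ {x y z} → x ≤ y + z → x - y ≤ z
  x≤y+z⇒x-y≤z {x} {y} {z} le = begin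
    x - y        ≤⟨ +-monoˡ-≤ (- y) le ⟩
    (y + z) - y  ≈⟨ +-congʳ (+-comm y z) ⟩
    (z + y) - y  ≈⟨ //-rightDividesʳ y z ⟩
    z            ∎

  neg-antimono-≤ : ∀ {x y} → x ≤ y → - y ≤ - x
  neg-antimono-≤ {x} {y} x≤y = +-cancelʳ-≤ y (begin
    - y + y  ≈⟨ -‿inverseˡ y ⟩
    0#       ≈⟨ -‿inverseˡ x ⟨
    - x + x  ≤⟨ +-monoʳ-≤ (- x) x≤y ⟩
    - x + y  ∎)

  nonPos⇒neg-nonNeg : ∀ {x} → x ≤ 0# → 0# ≤ - x
  nonPos⇒neg-nonNeg x≤0 = ≤-trans (≤-reflexive (sym -0#≈0#)) (neg-antimono-≤ x≤0)

  nonNeg⇒neg-nonPos : ∀ {x} → 0# ≤ x → - x ≤ 0#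
  nonNeg⇒neg-nonPos 0≤x = ≤-trans (neg-antimono-≤ 0≤x) (≤-reflexive -0#≈0#)

  x≤x+nonNeg : ∀ x {y} → 0# ≤ y → x ≤ x + y
  x≤x+nonNeg x {y} 0≤y = ≤-trans (≤-reflexive (sym (+-identityʳ x))) (+-monoʳ-≤ x 0≤y)

  x≤nonNeg+x : ∀ x {y} → 0# ≤ y → x ≤ y + x
  x≤nonNeg+x x {y} 0≤y = ≤-trans (x≤x+nonNeg x 0≤y) (≤-reflexive (+-comm x y))

  +-nonNeg : ∀ {x y} → 0# ≤ x → 0# ≤ y → 0# ≤ x + y
  +-nonNeg 0≤x 0≤y = ≤-trans 0≤x (x≤x+nonNeg _ 0≤y)

  *-monoˡ-≤ : ∀ {z x y} → 0# ≤ z → x ≤ y → z * x ≤ z * y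
  *-monoˡ-≤ {z} {x} {y} 0≤z x≤y = begin
    z * x                ≤⟨ x≤nonNeg+x (z * x) (*-nonNeg 0≤z 0≤y-x) ⟩
    z * (y - x) + z * x  ≈⟨ distribˡ z (y - x) x ⟨
    z * (y - x + x)      ≈⟨ *-congˡ (//-rightDividesˡ x y) ⟩
    z * y                ∎
    where
    0≤y-x : 0# ≤ y - x
    0≤y-x = ≤-trans (≤-reflexive (sym (-‿inverseʳ x))) (+-monoˡ-≤ (- x) x≤y)

  *-monoʳ-≤ : ∀ {z x y} → 0# ≤ z → x ≤ y → x * z ≤ y * z
  *-monoʳ-≤ {z} {x} {y} 0≤z x≤y = begin
    x * z  ≈⟨ *-comm x z ⟩
    z * x  ≤⟨ *-monoˡ-≤ 0≤z x≤y ⟩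
    z * y  ≈⟨ *-comm z y ⟩
    y * z  ∎

  *-nonPos : ∀ {x y} → x ≤ 0# → y ≤ 0# → 0# ≤ x * y
  *-nonPos {x} {y} x≤0 y≤0 = begin
    0#             ≤⟨ *-nonNeg (nonPos⇒neg-nonNeg x≤0) (nonPos⇒neg-nonNeg y≤0) ⟩
    (- x) * (- y)  ≈⟨ -‿distribˡ-* x (- y) ⟨
    - (x * (- y))  ≈⟨ -‿cong (-‿distribʳ-* x y) ⟨
    - - (x * y)    ≈⟨ -‿involutive (x * y) ⟩
    x * y          ∎

  0≤1 : 0# ≤ 1#
  0≤1 with ≤-total 0# 1#
  ... | inj₁ 0≤1 = 0≤1
  ... | inj₂ 1≤0 = ≤-trans (*-nonPos 1≤0 1≤0) (≤-reflexive (*-identityˡ 1#))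

  1≰0 : ¬ 1# ≤ 0#
  1≰0 1≤0 = 0≉1 (antisym 0≤1 1≤0)

  ≰⇒≥ : ∀ {x y} → ¬ x ≤ y → y ≤ x
  ≰⇒≥ {x} {y} x≰y = [ (λ x≤y → contradiction x≤y x≰y) , id ]′ (≤-total x y)

  ⁻¹-inverseˡ : ∀ {x} → ¬ x ≈ 0# → x ⁻¹ * x ≈ 1#
  ⁻¹-inverseˡ {x} x≉0 = trans (*-comm (x ⁻¹) x) (*-inverseʳ x x≉0)

  ⁻¹-nonNeg : ∀ {x} → 0# ≤ x → ¬ x ≈ 0# → 0# ≤ x ⁻¹
  ⁻¹-nonNeg {x} 0≤x x≉0 with ≤-total 0# (x ⁻¹)
  ... | inj₁ 0≤x⁻¹ = 0≤x⁻¹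
  ... | inj₂ x⁻¹≤0 = contradiction 1≤0 1≰0
    where
    1≤0 : 1# ≤ 0#
    1≤0 = begin
      1#        ≈⟨ *-inverseʳ x x≉0 ⟨
      x * x ⁻¹  ≤⟨ *-monoˡ-≤ 0≤x x⁻¹≤0 ⟩
      x * 0#    ≈⟨ zeroʳ x ⟩
      0#        ∎

  fromℕ-+ : ∀ m n → fromℕ (m ℕ.+ n) ≈ fromℕ m + fromℕ n
  fromℕ-+ = ×-homo-+ 1#

  fromℕ-nonNeg : ∀ n → 0# ≤ fromℕ n
  fromℕ-nonNeg zero    = ≤-refl
  fromℕ-nonNeg (suc n) = +-nonNeg 0≤1 (fromℕ-nonNeg n)

  fromℕ-mono-≤ : ∀ {m n} → m ℕ.≤ n → fromℕ m ≤ fromℕ n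
  fromℕ-mono-≤ {n = n} z≤n = fromℕ-nonNeg n
  fromℕ-mono-≤ (s≤s m≤n) = +-monoʳ-≤ 1# (fromℕ-mono-≤ m≤n)

  fromℕ-suc≉0 : ∀ n → ¬ fromℕ (suc n) ≈ 0#
  fromℕ-suc≉0 n eq = 1≰0 (≤-trans (x≤x+nonNeg 1# (fromℕ-nonNeg n)) (≤-reflexive eq))

  fromℕ1≈1 : fromℕ 1 ≈ 1#
  fromℕ1≈1 = +-identityʳ 1#

  open Max totalOrder using (x≤x⊔y; x≤y⊔x; ⊔-lub)
  open Min totalOrder public using (_⊓_; ⊓-glb; x⊓y≤x; x⊓y≤y)

  -- The closing bookkeeping: `e` counts bins of single items, `b` chosen patterns, `x` is the LP
  -- cost, `y` the discrepancy, and `z` stands for 1/k.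
  fromℕ-bound : ∀ {m e b x y z} → m ℕ.≤ e ℕ.+ b → fromℕ e ≤ y → fromℕ b ≤ x + z * y →
                fromℕ m ≤ x + (1# + z) * y
  fromℕ-bound {m} {e} {b} {x} {y} {z} m≤e+b e≤y b≤x+zy = begin
    fromℕ m               ≤⟨ fromℕ-mono-≤ m≤e+b ⟩
    fromℕ (e ℕ.+ b)       ≈⟨ fromℕ-+ e b ⟩
    fromℕ e + fromℕ b     ≤⟨ +-mono-≤ e≤y b≤x+zy ⟩
    y + (x + z * y)       ≈⟨ +-congʳ (*-identityˡ y) ⟨
    1# * y + (x + z * y)  ≈⟨ solve 4 (λ o x y z → o :* y :+ (x :+ z :* y) := x :+ (o :+ z) :* y) refl 1# x y z ⟩
    x + (1# + z) * y      ∎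

  y-x≤∣x-y∣ : ∀ x y → y - x ≤ ∣ x - y ∣
  y-x≤∣x-y∣ x y = ≤-trans (≤-reflexive (sym (-[x-y]≈y-x x y))) (x≤y⊔x _ _)

  0≤∣x∣ : ∀ x → 0# ≤ ∣ x ∣
  0≤∣x∣ x with ≤-total 0# x
  ... | inj₁ 0≤x = ≤-trans 0≤x (x≤x⊔y _ _)
  ... | inj₂ x≤0 = ≤-trans (nonPos⇒neg-nonNeg x≤0) (x≤y⊔x _ _)

  ∣x-y∣≤z⇒x≤y+z : ∀ {x y z} → ∣ x - y ∣ ≤ z → x ≤ y + z
  ∣x-y∣≤z⇒x≤y+z le = x-y≤z⇒x≤y+z (≤-trans (x≤x⊔y _ _) le)

  ∣x-y∣≤z⇒y≤x+z : ∀ {x y z} → ∣ x - y ∣ ≤ z → y ≤ x + z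
  ∣x-y∣≤z⇒y≤x+z le = x-y≤z⇒x≤y+z (≤-trans (y-x≤∣x-y∣ _ _) le)

  ∣x-y∣≤z : ∀ {x y z} → x ≤ y + z → y ≤ x + z → ∣ x - y ∣ ≤ z
  ∣x-y∣≤z {x} {y} x≤y+z y≤x+z =
    ⊔-lub (x≤y+z⇒x-y≤z x≤y+z)
          (≤-trans (≤-reflexive (-[x-y]≈y-x x y)) (x≤y+z⇒x-y≤z y≤x+z))

  -- Finite sums and linear dependence

  sum-cong : ∀ {n} {f g : Vector Carrier n} → (∀ i → f i ≈ g i) → sum f ≈ sum g
  sum-cong {n} = sum-cong-≋ {n}

  sum-mono-≤ : ∀ {n} {f g : Vector Carrier n} → (∀ i → f i ≤ g i) → sum f ≤ sum g
  sum-mono-≤ {zero}  f≤g = ≤-refl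
  sum-mono-≤ {suc n} f≤g = +-mono-≤ (f≤g zero) (sum-mono-≤ {n} (f≤g ∘ suc))

  sum-zero : ∀ {n} {f : Vector Carrier n} → (∀ i → f i ≈ 0#) → sum f ≈ 0#
  sum-zero {n} f≈0 = trans (sum-cong {n} f≈0) (sum-replicate-zero n)

  sum-nonNeg : ∀ {n} {f : Vector Carrier n} → (∀ i → 0# ≤ f i) → 0# ≤ sum f
  sum-nonNeg {zero}  0≤f = ≤-refl
  sum-nonNeg {suc n} 0≤f = +-nonNeg (0≤f zero) (sum-nonNeg {n} (0≤f ∘ suc))

  term≤sum : ∀ {n} {f : Vector Carrier n} → (∀ i → 0# ≤ f i) → ∀ i → f i ≤ sum f
  term≤sum {suc n} 0≤f zero    = x≤x+nonNeg _ (sum-nonNeg {n} (0≤f ∘ suc))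
  term≤sum {suc n} 0≤f (suc i) = ≤-trans (term≤sum {n} (0≤f ∘ suc) i) (x≤nonNeg+x _ (0≤f zero))

  sum-linear : ∀ {n} (a b : Vector Carrier n) c →
               sum {n} (λ j → a j + c * b j) ≈ sum a + c * sum b
  sum-linear {n} a b c =
    trans (∑-distrib-+ {n} a (λ j → c * b j)) (+-congˡ (sym (*-distribˡ-sum {n} c b)))

  -- Gaussian elimination: if some row p has a nonzero first entry, use it to
  -- clear the first column from the other rows.
  dependence : ∀ {n N} → n ℕ.< N → (A : Fin n → Fin N → Carrier) →
               Σ[ z ∈ Vector Carrier N ] (∃[ j ] ¬ z j ≈ 0#) × (∀ i → sum {N} (λ j → A i j * z j) ≈ 0#)
  dependence {zero}  {suc N} _ A = (λ _ → 1#) , (zero , λ eq → 0≉1 (sym eq)) , λ ()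
  dependence {suc n} {suc N} (s≤s n<N) A with any? (λ i → ¬? (A i zero ≟ 0#))
  ... | no  column≈0 = Vector._∷_ 1# (λ _ → 0#) , (zero , λ eq → 0≉1 (sym eq)) , λ i →
    trans (+-cong (trans (*-congʳ (decidable-stable (A i zero ≟ 0#) (λ ≉0 → column≈0 (i , ≉0))))
                         (zeroˡ 1#))
                  (sum-zero {N} (λ j → zeroʳ (A i (suc j)))))
          (+-identityʳ 0#)
  ... | yes (p , pivot≉0) with dependence n<N B
    where
    B : Fin n → Fin N → Carrier
    B i j = A (punchIn p i) (suc j) + (A (punchIn p i) zero * - (A p zero ⁻¹)) * A p (suc j)
  ...   | u , (j , uj≉0) , Bu≈0 = Vector._∷_ (g * S) u , (suc j , uj≉0) , solves
    where
    g = - (A p zero ⁻¹)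
    S = sum {N} (λ j → A p (suc j) * u j)

    solves : ∀ i → A i zero * (g * S) + sum {N} (λ j → A i (suc j) * u j) ≈ 0#
    solves i with p Fin.≟ i
    ... | yes ≡.refl = begin-equality
      A p zero * (g * S) + S             ≈⟨ +-congʳ (*-assoc _ _ _) ⟨
      (A p zero * g) * S + S             ≈⟨ +-congʳ (*-congʳ (-‿distribʳ-* _ _)) ⟨
      (- (A p zero * A p zero ⁻¹)) * S + S ≈⟨ +-congʳ (*-congʳ (-‿cong (*-inverseʳ _ pivot≉0))) ⟩
      (- 1#) * S + S                     ≈⟨ +-congʳ (-‿distribˡ-* 1# S) ⟨
      - (1# * S) + S                     ≈⟨ +-congʳ (-‿cong (*-identityˡ S)) ⟩
      - S + S                            ≈⟨ -‿inverseˡ S ⟩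
      0#                                 ∎
    ... | no p≢i = ≡.subst (λ i → A i zero * (g * S) + sum {N} (λ j → A i (suc j) * u j) ≈ 0#)
                           (punchIn-punchOut p≢i) (begin-equality
      A i′ zero * (g * S) + sum {N} (λ j → A i′ (suc j) * u j)
        ≈⟨ +-comm _ _ ⟩
      sum {N} (λ j → A i′ (suc j) * u j) + A i′ zero * (g * S)
        ≈⟨ +-congˡ (*-assoc _ _ _) ⟨
      sum {N} (λ j → A i′ (suc j) * u j) + (A i′ zero * g) * S
        ≈⟨ sum-linear {N} (λ j → A i′ (suc j) * u j) (λ j → A p (suc j) * u j) (A i′ zero * g) ⟨
      sum {N} (λ j → A i′ (suc j) * u j + (A i′ zero * g) * (A p (suc j) * u j))
        ≈⟨ sum-cong {N} (λ j → solve 4 (λ a b c u → (a :+ c :* b) :* u := a :* u :+ c :* (b :* u))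
                                     refl (A i′ (suc j)) (A p (suc j)) (A i′ zero * g) (u j)) ⟨
      sum {N} (λ j → (A i′ (suc j) + (A i′ zero * g) * A p (suc j)) * u j)
        ≈⟨ Bu≈0 (punchOut p≢i) ⟩
      0# ∎)
      where i′ = punchIn p (punchOut p≢i)

-- Fractional covers by n patterns with weights in the unit interval

module Reduction (R : CompleteOrderedField) where
  open CompleteOrderedField R hiding (zero)
  open OrderedField R
  open Data.List.Extrema totalOrder using (argmin; argmin-all; f[argmin]≤f[xs])
  open BinPacking R using (size; patterns; Feasible; objective)
  open import Algebra.Properties.Ring ring using (-1*x≈-x; -‿involutive; -‿distribˡ-*; -0#≈0#)

  -- If all entries were nonpositive, a sum of at least 0 would force each of them to vanish.
  positive-entry : ∀ {N} (z : Vector Carrier N) → (∃[ j ] ¬ z j ≈ 0#) → 0# ≤ sum z → ∃[ j ] ¬ z j ≤ 0#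
  positive-entry {N} z (j , zj≉0) 0≤Σz with any? (λ j → ¬? (z j ≤? 0#))
  ... | yes found = found
  ... | no  none  = contradiction (antisym (z≤0 j) 0≤zj) zj≉0
    where
    z≤0 : ∀ j → z j ≤ 0#
    z≤0 j = decidable-stable (z j ≤? 0#) (λ z≰0 → none (j , z≰0))
    -zj≤0 : - 1# * z j ≤ 0#
    -zj≤0 = begin
      - 1# * z j                   ≤⟨ term≤sum {N} (λ j → *-nonPos (nonNeg⇒neg-nonPos 0≤1) (z≤0 j)) j ⟩
      sum {N} (λ j → - 1# * z j)   ≈⟨ *-distribˡ-sum {N} (- 1#) z ⟨
      - 1# * sum z                 ≈⟨ -1*x≈-x (sum z) ⟩
      - sum z                      ≤⟨ nonNeg⇒neg-nonPos 0≤Σz ⟩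
      0#                           ∎
    0≤zj : 0# ≤ z j
    0≤zj = begin
      0#              ≤⟨ nonPos⇒neg-nonNeg -zj≤0 ⟩
      - (- 1# * z j)  ≈⟨ -‿cong (-1*x≈-x (z j)) ⟩
      - - z j         ≈⟨ -‿involutive (z j) ⟩
      z j             ∎

  -- A dependence may be negated, so its sum can be taken nonnegative. Subtracting a multiple of it
  -- from the weights then cannot raise the cost, and the positive entry guarantees that some weight
  -- eventually reaches 0.
  dependence⁺ : ∀ {n N} → n ℕ.< N → (A : Fin n → Fin N → Carrier) →
                Σ[ z ∈ Vector Carrier N ] (∃[ j ] ¬ z j ≤ 0#) × 0# ≤ sum z ×
                  (∀ i → sum {N} (λ j → A i j * z j) ≈ 0#)
  dependence⁺ {n} {N} n<N A with dependence n<N A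
  ... | z , z≉0 , Az≈0 with ≤-total 0# (sum z)
  ...   | inj₁ 0≤Σz = z , positive-entry z z≉0 0≤Σz , 0≤Σz , Az≈0
  ...   | inj₂ Σz≤0 = -z , positive-entry -z (proj₁ z≉0 , -zj≉0) 0≤Σ-z , 0≤Σ-z , A-z≈0
    where
    -z : Vector Carrier N
    -z j = - 1# * z j
    -zj≉0 : ¬ -z (proj₁ z≉0) ≈ 0#
    -zj≉0 eq = proj₂ z≉0 (begin-equality
      z (proj₁ z≉0)      ≈⟨ -‿involutive _ ⟨
      - - z (proj₁ z≉0)  ≈⟨ -‿cong (-1*x≈-x _) ⟨
      - (-z (proj₁ z≉0)) ≈⟨ -‿cong eq ⟩
      - 0#               ≈⟨ -0#≈0# ⟩
      0#                 ∎)
    0≤Σ-z : 0# ≤ sum -z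
    0≤Σ-z = begin
      0#             ≤⟨ *-nonPos (nonNeg⇒neg-nonPos 0≤1) Σz≤0 ⟩
      - 1# * sum z   ≈⟨ *-distribˡ-sum {N} (- 1#) z ⟩
      sum -z         ∎
    A-z≈0 : ∀ i → sum {N} (λ j → A i j * -z j) ≈ 0#
    A-z≈0 i = begin-equality
      sum {N} (λ j → A i j * (- 1# * z j))
        ≈⟨ sum-cong {N} (λ j → solve 3 (λ a c z → a :* (c :* z) := c :* (a :* z))
                                       refl (A i j) (- 1#) (z j)) ⟩
      sum {N} (λ j → - 1# * (A i j * z j))
        ≈⟨ *-distribˡ-sum {N} (- 1#) (λ j → A i j * z j) ⟨
      - 1# * sum {N} (λ j → A i j * z j)
        ≈⟨ *-congˡ (Az≈0 i) ⟩
      - 1# * 0#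
        ≈⟨ zeroʳ (- 1#) ⟩
      0# ∎

  bit-nonNeg : ∀ b → 0# ≤ (if b then 1# else 0#)
  bit-nonNeg true  = 0≤1
  bit-nonNeg false = ≤-refl

  bits-nonNeg : ∀ {n} (p : Vec Bool n) i → 0# ≤ bits R p i
  bits-nonNeg p i = bit-nonNeg (Vec.lookup p i)

  clamp-term : ∀ b x → let β = if b then 1# else 0# in β * x ≤ β * (x ⊓ 1#) ⊎ 1# ≤ β * (x ⊓ 1#)
  clamp-term false x = inj₁ (≤-reflexive (trans (zeroˡ _) (sym (zeroˡ _))))
  clamp-term true  x with ≤-total x 1#
  ... | inj₁ x≤1 = inj₁ (≤-reflexive refl)
  ... | inj₂ 1≤x = inj₂ (≤-reflexive (sym (*-identityˡ 1#)))

  clamped-nonNeg : ∀ {m} (β : Fin m → Bool) (w : Vector Carrier m) → (∀ j → 0# ≤ w j) →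
                   ∀ j → 0# ≤ (if β j then 1# else 0#) * (w j ⊓ 1#)
  clamped-nonNeg β w 0≤w j = *-nonNeg (bit-nonNeg (β j)) (⊓-glb (0≤w j) 0≤1)

  -- Clamping affects a contributing term only if its weight is at least 1, and the clamped weight 1
  -- then covers the item alone. If no contributing term is affected, the sum survives.
  clamp-sum : ∀ {m} (β : Fin m → Bool) (w : Vector Carrier m) → (∀ j → 0# ≤ w j) →
              sum {m} (λ j → (if β j then 1# else 0#) * w j)
                ≤ sum {m} (λ j → (if β j then 1# else 0#) * (w j ⊓ 1#)) ⊎
              1# ≤ sum {m} (λ j → (if β j then 1# else 0#) * (w j ⊓ 1#))
  clamp-sum {zero}  β w 0≤w = inj₁ ≤-refl
  clamp-sum {suc m} β w 0≤w
    with clamp-term (β zero) (w zero) | clamp-sum {m} (β ∘ suc) (w ∘ suc) (0≤w ∘ suc)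
  ... | inj₁ head≤ | inj₁ tail≤ = inj₁ (+-mono-≤ head≤ tail≤)
  ... | inj₂ 1≤    | _          = inj₂ (≤-trans 1≤ (term≤sum {suc m} (clamped-nonNeg β w 0≤w) zero))
  ... | inj₁ _     | inj₂ 1≤    = inj₂ (≤-trans 1≤ (x≤nonNeg+x _ (clamped-nonNeg β w 0≤w zero)))

  -- Only an inequality, because `i` may already belong to `p`.
  size-insert : ∀ {n} (s : Vector Carrier n) → (∀ i → 0# ≤ s i) → ∀ p i →
                size s (p [ i ]≔ true) ≤ size s p + s i
  size-insert {suc n} s 0≤s (b ∷ p) zero = begin
    s zero * 1# + size (s ∘ suc) p                ≈⟨ +-comm _ _ ⟩
    size (s ∘ suc) p + s zero * 1#                ≈⟨ +-congˡ (*-identityʳ (s zero)) ⟩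
    size (s ∘ suc) p + s zero
      ≤⟨ +-monoˡ-≤ (s zero) (x≤nonNeg+x _ (*-nonNeg (0≤s zero) (bits-nonNeg (b ∷ p) zero))) ⟩
    size s (b ∷ p) + s zero                       ∎
  size-insert {suc n} s 0≤s (b ∷ p) (suc i) = begin
    s zero * _ + size (s ∘ suc) (p [ i ]≔ true)
      ≤⟨ +-monoʳ-≤ _ (size-insert {n} (s ∘ suc) (0≤s ∘ suc) p i) ⟩
    s zero * _ + (size (s ∘ suc) p + s (suc i))
      ≈⟨ +-assoc _ _ _ ⟨
    size s (b ∷ p) + s (suc i) ∎

  ∅ : ∀ {n} → Vec Bool n
  ∅ {n} = Vec.replicate n false

  bits-∅ : ∀ {n} (i : Fin n) → bits R ∅ i ≈ 0#
  bits-∅ i rewrite Vec.lookup-replicate i false = refl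

  module _ {n : ℕ} (s : Vector Carrier n) where

    size-∅ : size s ∅ ≈ 0#
    size-∅ = sum-zero {n} (λ i → trans (*-congˡ (bits-∅ i)) (zeroʳ (s i)))

    -- A fractional solution detached from the list of patterns: columns may repeat and their number
    -- is a parameter, so that single columns can be added or removed.
    record Cover (m : ℕ) (v : Carrier) : Set where
      field
        column        : Fin m → Vec Bool n
        weight        : Vector Carrier m
        fits          : ∀ j → size s (column j) ≤ 1#
        weight-nonNeg : ∀ j → 0# ≤ weight j
        covers        : ∀ i → 1# ≤ sum {m} (λ j → bits R (column j) i * weight j)
        cost          : sum weight ≤ v

    feasible⇒cover : ∀ x → Feasible s x → Cover _ (objective s x)
    feasible⇒cover x (covers , 0≤x) = record
      { column        = List.lookup (patterns s)
      ; weight        = x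
      ; fits          = λ q → All.lookup (All.all-filter (λ p → size s p ≤? 1#) (allBoolVecs n)) (∈-lookup q)
      ; weight-nonNeg = 0≤x
      ; covers        = covers
      ; cost          = ≤-refl
      }

    pad : ∀ {m v} → Cover m v → Cover (suc m) v
    pad {m} C = record
      { column        = Vector._∷_ ∅ column
      ; weight        = Vector._∷_ 0# weight
      ; fits          = λ { zero → ≤-trans (≤-reflexive size-∅) 0≤1 ; (suc j) → fits j }
      ; weight-nonNeg = λ { zero → ≤-refl ; (suc j) → weight-nonNeg j }
      ; covers        = λ i → ≤-trans (covers i)
                                (x≤nonNeg+x _ (≤-reflexive (sym (zeroʳ (bits R ∅ i)))))
      ; cost          = ≤-trans (≤-reflexive (+-identityˡ _)) cost
      }
      where open Cover C

    -- Move along a dependence z of the columns with 0 ≤ Σ z until the first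
    -- weight vanishes: the coverage is unchanged and the cost does not rise.
    eliminate : ∀ {m v} → n ℕ.≤ m → Cover (suc m) v → Cover m v
    eliminate {m} {v} n≤m C = record
      { column        = column ∘ punchIn p
      ; weight        = w ∘ punchIn p
      ; fits          = fits ∘ punchIn p
      ; weight-nonNeg = w-nonNeg ∘ punchIn p
      ; covers        = λ i → begin
          1#
            ≤⟨ covers i ⟩
          sum {suc m} (λ j → bits R (column j) i * weight j)
            ≈⟨ +-identityʳ _ ⟨
          sum {suc m} (λ j → bits R (column j) i * weight j) + 0#
            ≈⟨ +-congˡ (trans (*-congˡ (Az≈0 i)) (zeroʳ (- t))) ⟨
          sum {suc m} (λ j → bits R (column j) i * weight j)
            + - t * sum {suc m} (λ j → bits R (column j) i * z j)
            ≈⟨ moved (λ j → bits R (column j) i) ⟩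
          sum {m} (λ j → bits R (column (punchIn p j)) i * w (punchIn p j)) ∎
      ; cost          = begin
          sum {m} (w ∘ punchIn p)
            ≈⟨ sum-cong {m} (λ j → *-identityˡ (w (punchIn p j))) ⟨
          sum {m} (λ j → 1# * w (punchIn p j))
            ≈⟨ moved (λ _ → 1#) ⟨
          sum {suc m} (λ j → 1# * weight j) + - t * sum {suc m} (λ j → 1# * z j)
            ≈⟨ +-cong (sum-cong {suc m} (λ j → *-identityˡ (weight j)))
                      (*-congˡ (sum-cong {suc m} (λ j → *-identityˡ (z j)))) ⟩
          sum weight + - t * sum z
            ≤⟨ +-monoʳ-≤ (sum weight) -tΣz≤0 ⟩
          sum weight + 0#
            ≈⟨ +-identityʳ _ ⟩
          sum weight
            ≤⟨ cost ⟩
          v ∎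
      }
      where
      open Cover C
      dep = dependence⁺ (s≤s n≤m) (λ i j → bits R (column j) i)
      z    = proj₁ dep
      j₀   = proj₁ (proj₁ (proj₂ dep))
      zj₀≰0 = proj₂ (proj₁ (proj₂ dep))
      0≤Σz = proj₁ (proj₂ (proj₂ dep))
      Az≈0 = proj₂ (proj₂ (proj₂ dep))

      Positive : Fin (suc m) → Set
      Positive j = ¬ z j ≤ 0#

      positive? : ∀ j → Dec (Positive j)
      positive? j = ¬? (z j ≤? 0#)

      positive⇒nonNeg : ∀ {j} → Positive j → 0# ≤ z j
      positive⇒nonNeg = ≰⇒≥

      positive⇒≉0 : ∀ {j} → Positive j → ¬ z j ≈ 0#
      positive⇒≉0 zj≰0 = zj≰0 ∘ ≤-reflexive

      ratio : Fin (suc m) → Carrier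
      ratio j = weight j * z j ⁻¹

      candidates : List (Fin (suc m))
      candidates = List.filter positive? (allFin (suc m))

      -- The ratio test of the simplex method: the smallest ratio is the step length at which the
      -- first weight vanishes. The default `j₀` is itself a positive index.
      p : Fin (suc m)
      p = argmin ratio j₀ candidates

      zp≰0 : Positive p
      zp≰0 = argmin-all ratio {P = Positive} zj₀≰0 (All.all-filter positive? (allFin (suc m)))

      t : Carrier
      t = ratio p

      t-nonNeg : 0# ≤ t
      t-nonNeg = *-nonNeg (weight-nonNeg p) (⁻¹-nonNeg (positive⇒nonNeg zp≰0) (positive⇒≉0 zp≰0))

      t≤ratio : ∀ {j} → Positive j → t ≤ ratio j
      t≤ratio {j} zj≰0 =
        All.lookup (f[argmin]≤f[xs] {f = ratio} j₀ candidates) (∈-filter⁺ positive? (∈-allFin j) zj≰0)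

      ratio-cancel : ∀ {j} → Positive j → ratio j * z j ≈ weight j
      ratio-cancel {j} zj≰0 = begin-equality
        (weight j * z j ⁻¹) * z j  ≈⟨ *-assoc _ _ _ ⟩
        weight j * (z j ⁻¹ * z j)  ≈⟨ *-congˡ (⁻¹-inverseˡ (positive⇒≉0 zj≰0)) ⟩
        weight j * 1#              ≈⟨ *-identityʳ _ ⟩
        weight j                   ∎

      w : Vector Carrier (suc m)
      w j = weight j + - t * z j

      wp≈0 : w p ≈ 0#
      wp≈0 = begin-equality
        weight p + - t * z p     ≈⟨ +-congˡ (-‿distribˡ-* t (z p)) ⟨
        weight p + - (t * z p)   ≈⟨ +-congˡ (-‿cong (ratio-cancel zp≰0)) ⟩
        weight p + - weight p    ≈⟨ -‿inverseʳ _ ⟩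
        0#                       ∎

      w-nonNeg : ∀ j → 0# ≤ w j
      -- A weight with `z j` at most 0 does not decrease; the others are protected by the minimality
      -- of `t`.
      w-nonNeg j with z j ≤? 0#
      ... | yes zj≤0 = +-nonNeg (weight-nonNeg j) (*-nonPos (nonNeg⇒neg-nonPos t-nonNeg) zj≤0)
      ... | no  zj≰0 = begin
        0#                       ≈⟨ -‿inverseʳ _ ⟨
        weight j + - weight j    ≤⟨ +-monoʳ-≤ (weight j) (neg-antimono-≤ tz≤w) ⟩
        weight j + - (t * z j)   ≈⟨ +-congˡ (-‿distribˡ-* t (z j)) ⟩
        weight j + - t * z j     ∎
        where
        tz≤w : t * z j ≤ weight j
        tz≤w = ≤-trans (*-monoʳ-≤ (positive⇒nonNeg zj≰0) (t≤ratio zj≰0))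
                       (≤-reflexive (ratio-cancel zj≰0))

      -tΣz≤0 : - t * sum z ≤ 0#
      -tΣz≤0 = ≤-trans (≤-reflexive (sym (-‿distribˡ-* t (sum z))))
                       (nonNeg⇒neg-nonPos (*-nonNeg t-nonNeg 0≤Σz))

      -- Serves coverage and cost alike: `g` is a row of the pattern matrix or constantly 1. Column
      -- `p` drops out because its new weight is 0.
      moved : ∀ (g : Vector Carrier (suc m)) →
              sum {suc m} (λ j → g j * weight j) + - t * sum {suc m} (λ j → g j * z j)
              ≈ sum {m} (λ j → g (punchIn p j) * w (punchIn p j))
      moved g = begin-equality
        sum {suc m} (λ j → g j * weight j) + - t * sum {suc m} (λ j → g j * z j)
          ≈⟨ sum-linear {suc m} (λ j → g j * weight j) (λ j → g j * z j) (- t) ⟨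
        sum {suc m} (λ j → g j * weight j + - t * (g j * z j))
          ≈⟨ sum-cong {suc m} (λ j → solve 4 (λ a b c d → a :* b :+ c :* (a :* d) := a :* (b :+ c :* d))
                                              refl (g j) (weight j) (- t) (z j)) ⟩
        sum {suc m} (λ j → g j * w j)
          ≈⟨ sum-remove {m} {p} (λ j → g j * w j) ⟩
        g p * w p + sum {m} (λ j → g (punchIn p j) * w (punchIn p j))
          ≈⟨ +-congʳ (trans (*-congˡ wp≈0) (zeroʳ (g p))) ⟩
        0# + sum {m} (λ j → g (punchIn p j) * w (punchIn p j))
          ≈⟨ +-identityˡ _ ⟩
        sum {m} (λ j → g (punchIn p j) * w (punchIn p j)) ∎

    padⁿ : ∀ k {m v} → Cover m v → Cover (k ℕ.+ m) v
    padⁿ zero    C = C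
    padⁿ (suc k) C = pad (padⁿ k C)

    eliminateⁿ : ∀ k {v} → Cover (k ℕ.+ n) v → Cover n v
    eliminateⁿ zero    C = C
    eliminateⁿ (suc k) C = eliminateⁿ k (eliminate (ℕ.m≤n+m n k) C)

    -- Padding with `n` empty patterns first makes exactly `m` eliminations lead to `n` columns,
    -- even if `m` was smaller than `n`.
    sparse-cover : ∀ {m v} → Cover m v → Cover n v
    sparse-cover {m} {v} C = eliminateⁿ m (≡.subst (λ k → Cover k v) (ℕ.+-comm n m) (padⁿ n C))

    -- Linear discrepancy speaks only of vectors in the unit cube, so weights above 1 have to be cut
    -- off.
    clamp : ∀ {m v} → Cover m v → Σ[ C ∈ Cover m v ] (∀ j → Cover.weight C j ≤ 1#)
    clamp {m} C = record
      { column        = column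
      ; weight        = λ j → weight j ⊓ 1#
      ; fits          = fits
      ; weight-nonNeg = λ j → ⊓-glb (weight-nonNeg j) 0≤1
      ; covers        = λ i → [ ≤-trans (covers i) , id ]′
                                (clamp-sum {m} (λ j → Vec.lookup (column j) i) weight weight-nonNeg)
      ; cost          = ≤-trans (sum-mono-≤ {m} (λ j → x⊓y≤x (weight j) 1#)) cost
      } , λ j → x⊓y≤y (weight j) 1#
      where open Cover C

-- Greedy packing into slots of larger items

module Packing (R : CompleteOrderedField) {n : ℕ} (s : Vector (CompleteOrderedField.Carrier R) n)
  (0≤s : ∀ i → CompleteOrderedField._≤_ R (CompleteOrderedField.0# R) (s i)) where
  open CompleteOrderedField R hiding (zero)
  open OrderedField R
  open Reduction R
  open BinPacking R s using (size)

  _∋_ : Vec Bool n → Fin n → Set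
  p ∋ i = Vec.lookup p i ≡ true

  bit : Vec Bool n → Fin n → ℕ
  bit p i = if Vec.lookup p i then 1 else 0

  fromℕ-bit : ∀ p i → fromℕ (bit p i) ≈ bits R p i
  fromℕ-bit p i with Vec.lookup p i
  ... | true  = fromℕ1≈1
  ... | false = refl

  count : Vec Bool n → List (Fin n) → ℕ
  count p []      = 0
  count p (i ∷ l) = bit p i ℕ.+ count p l

  load : Vec Bool n → List (Fin n) → Carrier
  load p []      = 0#
  load p (i ∷ l) = s i * bits R p i + load p l

  -- A bin of the given pattern `plan` while the items are packed in order of
  -- decreasing size: `free` slots of already treated items are still empty.
  record Bin : Set where
    constructor bin
    field
      content : Vec Bool n
      free    : ℕ
      plan    : Vec Bool n
  open Bin

  -- All free slots are at least as large as the current size bound c.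
  Fits : Carrier → List (Fin n) → Bin → Set
  Fits c l b = (size (content b) + fromℕ (free b) * c) + load (plan b) l ≤ 1#

  -- The supply for the items of `l`: slots that are already free, and those that open when the
  -- planned items in `l` are reached.
  capacity : List Bin → List (Fin n) → ℕ
  capacity []       l = 0
  capacity (b ∷ bs) l = (free b ℕ.+ count (plan b) l) ℕ.+ capacity bs l

  Covered : List Bin → Fin n → Set
  Covered bs i = Any (λ b → content b ∋ i) bs

  -- When item `i` is reached, a place that the plan reserves for it becomes an anonymous free slot.
  admit : Fin n → Bin → Bin
  admit i b = bin (content b) (free b ℕ.+ bit (plan b) i) (plan b)

  admit-capacity : ∀ i bs l → capacity (List.map (admit i) bs) l ≡ capacity bs (i ∷ l)
  admit-capacity i []       l = ≡.refl
  admit-capacity i (b ∷ bs) l =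
    ≡.cong₂ ℕ._+_ (ℕ.+-assoc (free b) _ _) (admit-capacity i bs l)

  -- The size reserved for `i` turns into a slot of the same size, while the older slots are merely
  -- revalued from `c` down to `s i`.
  admit-fits : ∀ {c i l} b → s i ≤ c → Fits c (i ∷ l) b → Fits (s i) l (admit i b)
  admit-fits {c} {i} {l} b si≤c fits = begin
    (size (content b) + fromℕ (free b ℕ.+ bit (plan b) i) * s i) + load (plan b) l
      ≈⟨ +-congʳ (+-congˡ (*-congʳ (trans (fromℕ-+ (free b) _) (+-congˡ (fromℕ-bit (plan b) i))))) ⟩
    (size (content b) + (fromℕ (free b) + bits R (plan b) i) * s i) + load (plan b) l
      ≈⟨ solve 5 (λ σ f β x r → (σ :+ (f :+ β) :* x) :+ r := (σ :+ f :* x) :+ (x :* β :+ r)) refl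
           (size (content b)) (fromℕ (free b)) (bits R (plan b) i) (s i) (load (plan b) l) ⟩
    (size (content b) + fromℕ (free b) * s i) + load (plan b) (i ∷ l)
      ≤⟨ +-monoˡ-≤ _ (+-monoʳ-≤ _ (*-monoˡ-≤ (fromℕ-nonNeg (free b)) si≤c)) ⟩
    (size (content b) + fromℕ (free b) * c) + load (plan b) (i ∷ l)
      ≤⟨ fits ⟩
    1# ∎

  admit-all : ∀ {c i l} bs → s i ≤ c → All (Fits c (i ∷ l)) bs →
              All (Fits (s i) l) (List.map (admit i) bs)
  admit-all         []       si≤c []           = []
  admit-all {l = l} (b ∷ bs) si≤c (fits ∷ all) = admit-fits {l = l} b si≤c fits ∷ admit-all {l = l} bs si≤c all

  -- The first alternative means that no bin has a free slot. Otherwise one free slot is consumed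
  -- and all plans stay, so the capacity drops by one for every list `l′`.
  fill : ∀ {l} i bs → All (Fits (s i) l) bs →
         capacity bs [] ≡ 0 ⊎
         ∃[ bs′ ] All (Fits (s i) l) bs′ × (∀ l′ → capacity bs l′ ≡ suc (capacity bs′ l′)) ×
                  (∀ {j} → Covered bs j → Covered bs′ j) × Covered bs′ i × length bs′ ≡ length bs
  fill i [] [] = inj₁ ≡.refl
  fill {l} i (bin σ (suc f) q ∷ bs) (fits ∷ all) =
    inj₂ (bin (σ [ i ]≔ true) f q ∷ bs , fits′ ∷ all , (λ l′ → ≡.refl) ,
          keep , here (Vec.lookup∘updateAt i σ) , ≡.refl)
    where
    fits′ : (size (σ [ i ]≔ true) + fromℕ f * s i) + load q l ≤ 1#
    fits′ = begin
      (size (σ [ i ]≔ true) + fromℕ f * s i) + load q l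
        ≤⟨ +-monoˡ-≤ _ (+-monoˡ-≤ _ (size-insert s 0≤s σ i)) ⟩
      ((size σ + s i) + fromℕ f * s i) + load q l
        ≈⟨ +-congʳ (+-congʳ (+-congˡ (*-identityˡ (s i)))) ⟨
      ((size σ + 1# * s i) + fromℕ f * s i) + load q l
        ≈⟨ solve 5 (λ σ u x f r → ((σ :+ u :* x) :+ f :* x) :+ r := (σ :+ (u :+ f) :* x) :+ r) refl
             (size σ) 1# (s i) (fromℕ f) (load q l) ⟩
      (size σ + fromℕ (suc f) * s i) + load q l
        ≤⟨ fits ⟩
      1# ∎
    keep : ∀ {j} → Covered (bin σ (suc f) q ∷ bs) j → Covered (bin (σ [ i ]≔ true) f q ∷ bs) j
    keep (there any) = there any
    keep {j} (here σ∋j) with j Fin.≟ i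
    ... | yes ≡.refl = here (Vec.lookup∘updateAt i σ)
    ... | no  j≢i    = here (≡.trans (Vec.lookup∘updateAt′ j i j≢i σ) σ∋j)
  fill {l} i (b@(bin σ zero q) ∷ bs) (fits ∷ all) with fill {l} i bs all
  ... | inj₁ empty = inj₁ empty
  ... | inj₂ (bs′ , all′ , eq , keep , new , len) =
    inj₂ (b ∷ bs′ , fits ∷ all′ ,
          (λ l′ → ≡.trans (≡.cong (count q l′ ℕ.+_) (eq l′)) (ℕ.+-suc _ _)) ,
          (λ { (here σ∋j) → here σ∋j ; (there any) → there (keep any) }) ,
          there new , ≡.cong suc len)

  Packing : (Fin n → Set) → ℕ → Set
  Packing P m = ∃[ ps ] length ps ℕ.≤ m × All (λ p → size p ≤ 1#) ps ×
                        (∀ i → P i → Any (_∋ i) ps)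

  -- Treat the items of l in order of decreasing size, putting each one into
  -- a free slot of an earlier, hence larger, item, or else into a bin of its
  -- own.  The budget condition says that e own bins suffice.
  pack : ∀ l {c bs e} → 0# ≤ c → (∀ i → s i ≤ 1#) →
         All (λ i → s i ≤ c) l → AllPairs (λ i j → s j ≤ s i) l →
         All (Fits c l) bs →
         (∀ t → t ℕ.≤ length l → t ℕ.≤ e ℕ.+ capacity bs (take t l)) →
         Packing (λ i → Covered bs i ⊎ i ∈ l) (e ℕ.+ length bs)
  pack [] {c} {bs} {e} 0≤c s≤1 _ _ all _ =
    List.map content bs ,
    ℕ.≤-trans (ℕ.≤-reflexive (length-map content bs)) (ℕ.m≤n+m _ e) ,
    All.map⁺ (All.map (λ {b} fits → ≤-trans (x≤x+nonNeg _ (*-nonNeg (fromℕ-nonNeg (free b)) 0≤c))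
                                             (≤-trans (≤-reflexive (sym (+-identityʳ _))) fits)) all) ,
    λ { i (inj₁ covered) → Any.map⁺ covered }
  pack (i ∷ l) {c} {bs} {e} 0≤c s≤1 (si≤c ∷ _) (sorted-i ∷ sorted) all budget
    with admitted ← admit-all {l = l} bs si≤c all
    with fill {l} i (List.map (admit i) bs) admitted
  ... | inj₂ (bs′ , all′ , eq , keep , new , len)
    with ps , len≤ , fit , cov ← pack l {s i} {bs′} {e} (0≤s i) s≤1 sorted-i sorted all′
      -- The item and the slot it takes cancel: the condition for `suc t` items loses one on each
      -- side, and `e` is kept.
      (λ t t≤ → ℕ.s≤s⁻¹ (ℕ.≤-trans (budget (suc t) (s≤s t≤))
        (ℕ.≤-reflexive (≡.trans (≡.cong (e ℕ.+_) (≡.trans (≡.sym (admit-capacity i bs (take t l))) (eq (take t l))))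
                                (ℕ.+-suc e _)))))
    = ps ,
      ℕ.≤-trans len≤ (ℕ.≤-reflexive (≡.cong (e ℕ.+_) (≡.trans len (length-map (admit i) bs)))) ,
      fit ,
      λ { j (inj₁ covered)        → cov j (inj₁ (keep (Any.map⁺ covered)))
        ; j (inj₂ (here ≡.refl)) → cov j (inj₁ new)
        ; j (inj₂ (there j∈l))   → cov j (inj₂ j∈l) }
  pack (i ∷ l) {c} {bs} {zero} 0≤c s≤1 (si≤c ∷ _) (sorted-i ∷ sorted) all budget
      | inj₁ empty = contradiction (ℕ.≤-trans (budget 1 (s≤s z≤n))
          (ℕ.≤-reflexive (≡.trans (≡.sym (admit-capacity i bs [])) empty))) (λ ())
  pack (i ∷ l) {c} {bs} {suc e} 0≤c s≤1 (si≤c ∷ _) (sorted-i ∷ sorted) all budget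
      | inj₁ empty
    with ps , len≤ , fit , cov ← pack l {s i} {List.map (admit i) bs} {e} (0≤s i) s≤1 sorted-i sorted admitted
      -- Here `i` uses up one of the own bins instead, and the capacity is untouched.
      (λ t t≤ → ℕ.s≤s⁻¹ (ℕ.≤-trans (budget (suc t) (s≤s t≤))
        (ℕ.≤-reflexive (≡.cong (suc e ℕ.+_) (≡.sym (admit-capacity i bs (take t l)))))))
    = (∅ [ i ]≔ true) ∷ ps ,
      s≤s (ℕ.≤-trans len≤ (ℕ.≤-reflexive (≡.cong (e ℕ.+_) (length-map (admit i) bs)))) ,
      single-fits ∷ fit ,
      λ { j (inj₁ covered)        → there (cov j (inj₁ (Any.map⁺ covered)))
        ; j (inj₂ (here ≡.refl)) → here (Vec.lookup∘updateAt i ∅)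
        ; j (inj₂ (there j∈l))   → there (cov j (inj₂ j∈l)) }
    where
    single-fits : size (∅ [ i ]≔ true) ≤ 1#
    single-fits = begin
      size (∅ [ i ]≔ true)  ≤⟨ size-insert s 0≤s ∅ i ⟩
      size ∅ + s i        ≈⟨ +-congʳ (size-∅ s) ⟩
      0# + s i                  ≈⟨ +-identityˡ (s i) ⟩
      s i                       ≤⟨ s≤1 i ⟩
      1#                        ∎

-- Rounding by linear discrepancy

module Rounding (R : CompleteOrderedField) where
  open CompleteOrderedField R hiding (zero)
  open OrderedField R
  open Reduction R
  open Data.List.Extrema totalOrder using (argmin-sel; min≤⊤; xs≤max; max≤v⁺)

  InUnitCube : ∀ {n} → Vector Carrier n → Set
  InUnitCube y = ∀ j → 0# ≤ y j × y j ≤ 1#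

  fromℕᴹ : ∀ {m n} → Matrix R ℕ m n → Matrix R Carrier m n
  fromℕᴹ A i j = fromℕ (A i j)

  error : ∀ {m n} → Matrix R Carrier m n → Vector Carrier n → Vec Bool n → Carrier
  error A y x = ‖_‖∞ R (λ i → _*ᵥ_ R A (bits R x) i - _*ᵥ_ R A y i)

  ∣i∣≤‖‖∞ : ∀ {m} (v : Vector Carrier m) i → ∣ v i ∣ ≤ ‖_‖∞ R v
  ∣i∣≤‖‖∞ v i = All.lookup (xs≤max 0# (List.tabulate (λ i → ∣ v i ∣))) (∈-tabulate⁺ i)

  -- `min` returns either its default or an entry of the list, and both are errors of 0/1 vectors.
  roundingError-attained : ∀ {m n} (A : Matrix R Carrier m n) y →
                           ∃[ x ] roundingError R A y ≡ error A y x
  roundingError-attained {n = n} A y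
    with argmin-sel id (error A y (Vec.replicate n false)) (List.map (error A y) (allBoolVecs n))
  ... | inj₁ eq  = Vec.replicate n false , eq
  ... | inj₂ mem with x , _ , eq ← ∈-map⁻ (error A y) mem = x , eq

  module _ {k m n : ℕ} (A : Matrix R ℕ m n) (mon : Monotone R k A) where

    -- Rounding everything down to 0 already achieves this. The bound is independent of `y`, of the
    -- entries and of the number of rows, so it shows that the sets behind `lindisc` and `Dmon` are
    -- bounded, as needed for `sup` to be their supremum.
    roundingError-bound : ∀ y → InUnitCube y → roundingError R (fromℕᴹ A) y ≤ sum {n} (λ _ → fromℕ k)
    roundingError-bound y 0≤y≤1 = ≤-trans
      (min≤⊤ _ (List.map (error (fromℕᴹ A) y) (allBoolVecs n)))
      (max≤v⁺ (sum-nonNeg {n} (λ _ → fromℕ-nonNeg k)) (All.tabulate⁺ (λ i → ∣x-y∣≤z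
        (≤-trans (≤-reflexive (A∅≈0 i)) (+-nonNeg (Ay-nonNeg i) (sum-nonNeg {n} (λ _ → fromℕ-nonNeg k))))
        (≤-trans (Ay≤ i) (x≤nonNeg+x _ (≤-reflexive (sym (A∅≈0 i))))))))
      where
      A∅≈0 : ∀ i → sum {n} (λ j → fromℕ (A i j) * bits R ∅ j) ≈ 0#
      A∅≈0 i = sum-zero {n} (λ j → trans (*-congˡ (bits-∅ j)) (zeroʳ _))
      Ay-nonNeg : ∀ i → 0# ≤ sum {n} (λ j → fromℕ (A i j) * y j)
      Ay-nonNeg i = sum-nonNeg {n} (λ j → *-nonNeg (fromℕ-nonNeg (A i j)) (proj₁ (0≤y≤1 j)))
      Ay≤ : ∀ i → sum {n} (λ j → fromℕ (A i j) * y j) ≤ sum {n} (λ _ → fromℕ k)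
      Ay≤ i = sum-mono-≤ {n} (λ j → begin
        fromℕ (A i j) * y j  ≤⟨ *-monoˡ-≤ (fromℕ-nonNeg (A i j)) (proj₂ (0≤y≤1 j)) ⟩
        fromℕ (A i j) * 1#   ≈⟨ *-identityʳ _ ⟩
        fromℕ (A i j)        ≤⟨ fromℕ-mono-≤ (Monotone.bounded mon i j) ⟩
        fromℕ k              ∎)

    lindisc-isSupremum : IsSupremum _≤_ (λ v → ∃[ y ] InUnitCube y × v ≈ roundingError R (fromℕᴹ A) y)
                                        (lindisc R (fromℕᴹ A))
    lindisc-isSupremum = sup-isSupremum _
      (_ , (λ _ → 0#) , (λ _ → ≤-refl , 0≤1) , refl)
      (_ , λ { v (y , y∈ , v≈) → ≤-trans (≤-reflexive v≈) (roundingError-bound y y∈) })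

    lindisc-bound : lindisc R (fromℕᴹ A) ≤ sum {n} (λ _ → fromℕ k)
    lindisc-bound = proj₂ lindisc-isSupremum _
      (λ { v (y , y∈ , v≈) → ≤-trans (≤-reflexive v≈) (roundingError-bound y y∈) })

  lindisc≤Dmon : ∀ {k m n} (A : Matrix R ℕ m n) → Monotone R k A → lindisc R (fromℕᴹ A) ≤ Dmon R k n
  lindisc≤Dmon {k} {m} {n} A mon = proj₁
    (sup-isSupremum _ (_ , m , A , mon , refl)
      (_ , λ { v (m , A , mon , v≈) → ≤-trans (≤-reflexive v≈) (lindisc-bound {m = m} A mon) }))
    _ (m , A , mon , refl)

  round : ∀ {k m n} (A : Matrix R ℕ m n) → Monotone R k A → ∀ y → InUnitCube y →
          ∃[ x ] ∀ i → ∣ _*ᵥ_ R (fromℕᴹ A) (bits R x) i - _*ᵥ_ R (fromℕᴹ A) y i ∣ ≤ Dmon R k n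
  round {k} {m} {n} A mon y y∈ with x , eq ← roundingError-attained (fromℕᴹ A) y =
    x , λ i → begin
      _                              ≤⟨ ∣i∣≤‖‖∞ (λ i → _*ᵥ_ R (fromℕᴹ A) (bits R x) i - _*ᵥ_ R (fromℕᴹ A) y i) i ⟩
      error (fromℕᴹ A) y x           ≡⟨ eq ⟨
      roundingError R (fromℕᴹ A) y   ≤⟨ proj₁ (lindisc-isSupremum A mon) _ (y , y∈ , refl) ⟩
      lindisc R (fromℕᴹ A)           ≤⟨ lindisc≤Dmon A mon ⟩
      Dmon R k n                     ∎

  select : ∀ {A : Set} {m} → Vec Bool m → (Fin m → A) → List A
  select []          P = []
  select (false ∷ x) P = select x (P ∘ suc)
  select (true  ∷ x) P = P zero ∷ select x (P ∘ suc)

  select⁺ : ∀ {A : Set} {Q : A → Set} {m} (x : Vec Bool m) {P : Fin m → A} → (∀ j → Q (P j)) → All Q (select x P)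
  select⁺ []          q = []
  select⁺ (false ∷ x) q = select⁺ x (q ∘ suc)
  select⁺ (true  ∷ x) q = q zero ∷ select⁺ x (q ∘ suc)

  length-select : ∀ {A : Set} {m} (x : Vec Bool m) (P : Fin m → A) →
                  fromℕ (length (select x P)) ≈ sum (bits R x)
  length-select []          P = refl
  length-select (false ∷ x) P = trans (length-select x (P ∘ suc)) (sym (+-identityˡ _))
  length-select (true  ∷ x) P = +-congˡ (length-select x (P ∘ suc))

  -- The witness is the largest deficit of `S t` below `t`, or 0 if there is none. As the deficit of
  -- an actual `t` it is at most `D`, so the real number `D` never has to be rounded down.
  shortfall : ∀ {D} n (S : ℕ → ℕ) → 0# ≤ D → (∀ t → t ℕ.≤ n → fromℕ t ≤ fromℕ (S t) + D) →
              ∃[ e ] (∀ t → t ℕ.≤ n → t ℕ.≤ e ℕ.+ S t) × fromℕ e ≤ D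
  shortfall zero    S 0≤D near = 0 , (λ { zero z≤n → z≤n }) , 0≤D
  shortfall {D} (suc n) S 0≤D near
    with shortfall n S 0≤D (λ t t≤n → near t (ℕ.m≤n⇒m≤1+n t≤n))
  ... | e , enough , e≤D with suc n ℕ.≤? e ℕ.+ S (suc n)
  ...   | yes last = e , (λ t t≤ → [ enough t ∘ ℕ.s≤s⁻¹ , (λ { ≡.refl → last }) ]′ (ℕ.m≤n⇒m<n∨m≡n t≤)) , e≤D
  ...   | no  short = suc n ℕ.∸ S (suc n) , enough′ , +-cancelʳ-≤ (fromℕ (S (suc n))) (begin
      fromℕ (suc n ℕ.∸ S (suc n)) + fromℕ (S (suc n))  ≈⟨ fromℕ-+ (suc n ℕ.∸ S (suc n)) _ ⟨
      fromℕ (suc n ℕ.∸ S (suc n) ℕ.+ S (suc n))        ≡⟨ ≡.cong fromℕ (ℕ.m∸n+n≡m S≤) ⟩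
      fromℕ (suc n)                                    ≤⟨ near (suc n) ℕ.≤-refl ⟩
      fromℕ (S (suc n)) + D                            ≈⟨ +-comm _ _ ⟩
      D + fromℕ (S (suc n))                            ∎)
    where
    short′ : e ℕ.+ S (suc n) ℕ.< suc n
    short′ = ℕ.≰⇒> short
    S≤ : S (suc n) ℕ.≤ suc n
    S≤ = ℕ.≤-trans (ℕ.m≤n+m _ e) (ℕ.<⇒≤ short′)
    e≤ : e ℕ.≤ suc n ℕ.∸ S (suc n)
    e≤ = ℕ.m+n≤o⇒m≤o∸n e (ℕ.<⇒≤ short′)
    enough′ : ∀ t → t ℕ.≤ suc n → t ℕ.≤ suc n ℕ.∸ S (suc n) ℕ.+ S t
    enough′ t t≤ with ℕ.m≤n⇒m<n∨m≡n t≤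
    ... | inj₁ t<   = ℕ.≤-trans (enough t (ℕ.s≤s⁻¹ t<)) (ℕ.+-monoˡ-≤ (S t) e≤)
    ... | inj₂ ≡.refl = ℕ.≤-reflexive (≡.sym (ℕ.m∸n+n≡m S≤))

  -- Integral LP solutions from lists of patterns

  δ : ∀ {n} → Fin n → Fin n → ℕ
  δ zero    zero    = 1
  δ zero    (suc j) = 0
  δ (suc i) zero    = 0
  δ (suc i) (suc j) = δ i j

  δ-diagonal : ∀ {n} (i : Fin n) → δ i i ≡ 1
  δ-diagonal zero    = ≡.refl
  δ-diagonal (suc i) = δ-diagonal i

  sum-δ : ∀ {n} (i : Fin n) → sum (λ j → fromℕ (δ i j)) ≈ 1#
  sum-δ {suc n} zero    = trans (+-cong fromℕ1≈1 (sum-replicate-zero n)) (+-identityʳ 1#)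
  sum-δ {suc n} (suc i) = trans (+-identityˡ _) (sum-δ {n} i)

  ∈-allBoolVecs : ∀ {n} (p : Vec Bool n) → p ∈ allBoolVecs n
  ∈-allBoolVecs []          = here ≡.refl
  ∈-allBoolVecs {suc n} (false ∷ p) = ∈-++⁺ˡ (∈-map⁺ (false ∷_) (∈-allBoolVecs p))
  ∈-allBoolVecs {suc n} (true  ∷ p) =
    ∈-++⁺ʳ (List.map (false ∷_) (allBoolVecs n)) (∈-map⁺ (true ∷_) (∈-allBoolVecs p))

  module _ {n : ℕ} (s : Vector Carrier n) where
    open BinPacking R s

    position : ∀ p → size p ≤ 1# → Fin (length patterns)
    position p fits = Any.index (∈-filter⁺ (λ p → size p ≤? 1#) (∈-allBoolVecs p) fits)

    lookup-position : ∀ p (fits : size p ≤ 1#) → p ≡ List.lookup patterns (position p fits)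
    lookup-position p fits = Any.lookup-index (∈-filter⁺ (λ p → size p ≤? 1#) (∈-allBoolVecs p) fits)

    multiplicity : ∀ {ps} → All (λ p → size p ≤ 1#) ps → Fin (length patterns) → ℕ
    multiplicity []         q = 0
    multiplicity {p ∷ _} (fits ∷ a) q = δ (position p fits) q ℕ.+ multiplicity a q

    sum-multiplicity : ∀ {ps} (a : All (λ p → size p ≤ 1#) ps) →
                       sum (λ q → fromℕ (multiplicity a q)) ≈ fromℕ (length ps)
    sum-multiplicity [] = sum-replicate-zero (length patterns)
    sum-multiplicity {p ∷ ps} (fits ∷ a) = begin-equality
      sum (λ q → fromℕ (δ (position p fits) q ℕ.+ multiplicity a q))
        ≈⟨ sum-cong {length patterns} (λ q → fromℕ-+ (δ (position p fits) q) (multiplicity a q)) ⟩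
      sum (λ q → fromℕ (δ (position p fits) q) + fromℕ (multiplicity a q))
        ≈⟨ ∑-distrib-+ {length patterns} _ _ ⟩
      sum (λ q → fromℕ (δ (position p fits) q)) + sum (λ q → fromℕ (multiplicity a q))
        ≈⟨ +-cong (sum-δ (position p fits)) (sum-multiplicity a) ⟩
      fromℕ (length (p ∷ ps)) ∎

    multiplicity-covers : ∀ {ps i} (a : All (λ p → size p ≤ 1#) ps) → Any (λ p → Vec.lookup p i ≡ true) ps →
                          ∃[ q ] Vec.lookup (List.lookup patterns q) i ≡ true × 1 ℕ.≤ multiplicity a q
    multiplicity-covers {p ∷ _} (fits ∷ a) (here p∋i) =
      position p fits ,
      ≡.subst (λ p → Vec.lookup p _ ≡ true) (lookup-position p fits) p∋i ,
      ℕ.≤-trans (ℕ.≤-reflexive (≡.sym (δ-diagonal (position p fits)))) (ℕ.m≤m+n _ _)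
    multiplicity-covers (fits ∷ a) (there any) with q , q∋i , 1≤ ← multiplicity-covers a any =
      q , q∋i , ℕ.≤-trans 1≤ (ℕ.m≤n+m _ _)

    -- The LP variable of a pattern counts its occurrences in `ps`; repetitions are harmless because
    -- the multiplicities add up to the number of bins.
    integral-solution : ∀ ps → All (λ p → size p ≤ 1#) ps →
                        (∀ i → Any (λ p → Vec.lookup p i ≡ true) ps) →
                        ∃[ x ] (Feasible x × Integral x) × fromℕ (length ps) ≈ objective x
    integral-solution ps a covered =
      (λ q → fromℕ (multiplicity a q)) ,
      ((covers , λ q → fromℕ-nonNeg (multiplicity a q)) , λ q → + multiplicity a q , refl) ,
      sym (sum-multiplicity a)
      where
      covers : ∀ i → 1# ≤ sum (λ q → bits R (List.lookup patterns q) i * fromℕ (multiplicity a q))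
      covers i with q , q∋i , 1≤ ← multiplicity-covers a (covered i) = ≤-trans 1≤term
        (term≤sum {length patterns}
          (λ q → *-nonNeg (bits-nonNeg (List.lookup patterns q) i) (fromℕ-nonNeg (multiplicity a q))) q)
        where
        1≤term : 1# ≤ bits R (List.lookup patterns q) i * fromℕ (multiplicity a q)
        1≤term rewrite q∋i = begin
          1#                             ≈⟨ fromℕ1≈1 ⟨
          fromℕ 1                        ≤⟨ fromℕ-mono-≤ 1≤ ⟩
          fromℕ (multiplicity a q)       ≈⟨ *-identityˡ _ ⟨
          1# * fromℕ (multiplicity a q)  ∎

-- Sorted items, members per pattern, and the two optima

module Bound (R : CompleteOrderedField) {n : ℕ} (s : Vector (CompleteOrderedField.Carrier R) n)
  (0≤s : ∀ i → CompleteOrderedField._≤_ R (CompleteOrderedField.0# R) (s i))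
  (s≤1 : ∀ i → CompleteOrderedField._≤_ R (s i) (CompleteOrderedField.1# R)) where
  open CompleteOrderedField R hiding (zero)
  open OrderedField R
  open Reduction R
  open Packing R s 0≤s
  open Rounding R
  open BinPacking R s using (size; Feasible; Integral; objective)

  decreasing : DecTotalOrder _ _ _
  decreasing = On.decTotalOrder (Flip.decTotalOrder decTotalOrder) s

  open Data.List.Sort decreasing using (sort; sort-↭; sort-↗)

  items : List (Fin n)
  items = sort (allFin n)

  items-sorted : AllPairs (λ i j → s j ≤ s i) items
  items-sorted = Linked.Linked⇒AllPairs (λ j≤i k≤j → ≤-trans k≤j j≤i) (sort-↗ (allFin n))

  ∈-items : ∀ i → i ∈ items
  ∈-items i = Perm.∈-resp-↭ (Perm.↭-sym (sort-↭ (allFin n))) (∈-allFin i)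

  length-items : length items ≡ n
  length-items = ≡.trans (Perm.↭-length (sort-↭ (allFin n))) (length-tabulate id)

  load-↭ : ∀ p {xs ys} → xs ↭ ys → load p xs ≈ load p ys
  load-↭ p Perm.refl          = refl
  load-↭ p (Perm.prep i eq)   = +-congˡ (load-↭ p eq)
  load-↭ p (Perm.swap {xs} {ys} i j eq) = begin-equality
    a + (b + load p xs)  ≈⟨ +-congˡ (+-congˡ (load-↭ p eq)) ⟩
    a + (b + load p ys)  ≈⟨ solve 3 (λ a b c → a :+ (b :+ c) := b :+ (a :+ c)) refl a b (load p ys) ⟩
    b + (a + load p ys)  ∎
    where
    a = s i * bits R p i
    b = s j * bits R p j
  load-↭ p (Perm.trans eq eq′) = trans (load-↭ p eq) (load-↭ p eq′)

  load-tabulate : ∀ p {m} (f : Fin m → Fin n) →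
                  load p (List.tabulate f) ≈ sum (λ j → s (f j) * bits R p (f j))
  load-tabulate p {zero}  f = refl
  load-tabulate p {suc m} f = +-congˡ (load-tabulate p (f ∘ suc))

  load-items : ∀ p → load p items ≈ size p
  load-items p = trans (load-↭ p (sort-↭ (allFin n))) (load-tabulate p id)

  module _ {c : Carrier} (0≤c : 0# ≤ c) (c<s : ∀ i → c < s i) where

    count*c≤load : ∀ p l → fromℕ (count p l) * c ≤ load p l
    count*c≤load p []      = ≤-reflexive (zeroˡ c)
    count*c≤load p (i ∷ l) with Vec.lookup p i
    ... | true  = begin
      (1# + fromℕ (count p l)) * c     ≈⟨ distribʳ c 1# _ ⟩
      1# * c + fromℕ (count p l) * c   ≤⟨ +-mono-≤ (≤-trans (*-monoˡ-≤ 0≤1 (proj₁ (c<s i))) (≤-reflexive (*-comm 1# (s i)))) (count*c≤load p l) ⟩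
      s i * 1# + load p l              ∎
    ... | false = ≤-trans (count*c≤load p l) (x≤nonNeg+x _ (*-nonNeg (0≤s i) ≤-refl))

    -- One member suffices for strictness: its size exceeds `c` strictly, and the weak bound handles
    -- the rest.
    load≰count*c : ∀ p l → 1 ℕ.≤ count p l → ¬ load p l ≤ fromℕ (count p l) * c
    load≰count*c p (i ∷ l) 1≤count le with Vec.lookup p i
    ... | false = load≰count*c p l 1≤count (≤-trans (x≤nonNeg+x _ (*-nonNeg (0≤s i) ≤-refl)) le)
    ... | true  = proj₂ (c<s i) (antisym (proj₁ (c<s i)) (+-cancelʳ-≤ (fromℕ (count p l) * c) (begin
      s i + fromℕ (count p l) * c      ≈⟨ +-congʳ (*-identityʳ (s i)) ⟨
      s i * 1# + fromℕ (count p l) * c  ≤⟨ +-monoʳ-≤ _ (count*c≤load p l) ⟩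
      s i * 1# + load p l              ≤⟨ le ⟩
      (1# + fromℕ (count p l)) * c     ≈⟨ distribʳ c 1# _ ⟩
      1# * c + fromℕ (count p l) * c   ≈⟨ +-congʳ (*-identityˡ c) ⟩
      c + fromℕ (count p l) * c        ∎)))

  -- More than k members, each larger than 1/(k+1), would have total size above 1. Strictness is
  -- essential: k+1 items of size exactly 1/(k+1) do fit.
  count-items≤ : ∀ {k} → (∀ i → fromℕ (suc k) ⁻¹ < s i) → ∀ p → size p ≤ 1# → count p items ℕ.≤ k
  count-items≤ {k} c<s p fits with count p items ℕ.≤? k
  ... | yes count≤k = count≤k
  ... | no  count≰k = contradiction (begin
      load p items                     ≈⟨ load-items p ⟩
      size p                           ≤⟨ fits ⟩
      1#                               ≈⟨ *-inverseʳ (fromℕ (suc k)) (fromℕ-suc≉0 k) ⟨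
      fromℕ (suc k) * c                ≤⟨ *-monoʳ-≤ 0≤c (fromℕ-mono-≤ k<count) ⟩
      fromℕ (count p items) * c        ∎)
      (load≰count*c 0≤c c<s p items (ℕ.≤-trans (s≤s z≤n) k<count))
    where
    c = fromℕ (suc k) ⁻¹
    0≤c = ⁻¹-nonNeg (fromℕ-nonNeg (suc k)) (fromℕ-suc≉0 k)
    k<count = ℕ.≰⇒> count≰k

  count-take-mono : ∀ p l {t u} → t ℕ.≤ u → count p (take t l) ℕ.≤ count p (take u l)
  count-take-mono p []      {t} {u} _ = ℕ.≤-trans (ℕ.≤-reflexive (≡.cong (count p) (take-[] t))) z≤n
  count-take-mono p (i ∷ l) z≤n       = z≤n
  count-take-mono p (i ∷ l) (s≤s t≤u) = ℕ.+-monoʳ-≤ _ (count-take-mono p l t≤u)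

  count-take≤ : ∀ p l t → count p (take t l) ℕ.≤ count p l
  count-take≤ p l       zero    = z≤n
  count-take≤ p []      (suc t) = z≤n
  count-take≤ p (i ∷ l) (suc t) = ℕ.+-monoʳ-≤ _ (count-take≤ p l t)

  empty-bin : Vec Bool n → Bin
  empty-bin = bin ∅ 0

  empty-bin-fits : ∀ p → size p ≤ 1# → Fits 1# items (empty-bin p)
  empty-bin-fits p fits = begin
    (size ∅ + 0# * 1#) + load p items   ≈⟨ +-cong (+-cong (size-∅ s) (zeroˡ 1#)) (load-items p) ⟩
    (0# + 0#) + size p                  ≈⟨ trans (+-congʳ (+-identityʳ 0#)) (+-identityˡ _) ⟩
    size p                              ≤⟨ fits ⟩
    1#                                  ∎

  -- Translates a row of the rounded system into the capacity on which the greedy packing relies.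
  capacity-select : ∀ {m} (x : Vec Bool m) (P : Fin m → Vec Bool n) l →
                    sum {m} (λ j → fromℕ (count (P j) l) * bits R x j)
                    ≈ fromℕ (capacity (select x (empty-bin ∘ P)) l)
  capacity-select []          P l = refl
  capacity-select {suc m} (false ∷ x) P l = trans (+-cong (zeroʳ _) (capacity-select {m} x (P ∘ suc) l)) (+-identityˡ _)
  capacity-select {suc m} (true  ∷ x) P l =
    trans (+-cong (*-identityʳ _) (capacity-select {m} x (P ∘ suc) l)) (sym (fromℕ-+ (count (P zero) l) _))

  pack-items : ∀ {bs e} → All (Fits 1# items) bs →
               (∀ t → t ℕ.≤ n → t ℕ.≤ e ℕ.+ capacity bs (take t items)) →
               ∃[ m ] m ℕ.≤ e ℕ.+ length bs ×
               (∃[ x ] (Feasible x × Integral x) × fromℕ m ≈ objective x)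
  pack-items {bs} {e} all budget
    with ps , len≤ , fit , covered ← pack items {1#} {bs} {e} 0≤1 s≤1 (All.universal s≤1 items) items-sorted all
                                       (λ t t≤ → budget t (ℕ.≤-trans t≤ (ℕ.≤-reflexive length-items)))
    = length ps , len≤ , integral-solution s ps fit (λ i → covered i (inj₂ (∈-items i)))

  objective-nonNeg : ∀ {x} → Feasible x → 0# ≤ objective x
  objective-nonNeg (_ , 0≤x) = sum-nonNeg {length (BinPacking.patterns R s)} 0≤x

  -- Packing with no planned bins puts each item into a bin of its own. This solution shows that the
  -- sets behind `OPT` and `OPTf` are nonempty.
  some-integral : ∃[ v ] ∃[ x ] (Feasible x × Integral x) × v ≈ objective x
  some-integral with m , _ , sol ← pack-items {[]} {n} [] (λ t t≤n → ℕ.≤-trans t≤n (ℕ.m≤m+n n 0))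
    = fromℕ m , sol

  OPT≤ : ∀ {v} → (∃[ x ] (Feasible x × Integral x) × v ≈ objective x) → OPT R s ≤ v
  OPT≤ {v} sol = proj₁ (inf-isInfimum _ some-integral
    (0# , λ { v (x , (feasible , _) , v≈) → ≤-trans (objective-nonNeg feasible) (≤-reflexive (sym v≈)) })) v sol

  ≤OPTf : ∀ {b} → (∀ x → Feasible x → b ≤ objective x) → b ≤ OPTf R s
  ≤OPTf {b} lower with v , x , (feasible , _) , v≈ ← some-integral =
    proj₂ (inf-isInfimum _ (v , x , feasible , v≈)
      (0# , λ { v (x , feasible , v≈) → ≤-trans (objective-nonNeg feasible) (≤-reflexive (sym v≈)) }))
    b (λ { v (x , feasible , v≈) → ≤-trans (lower x feasible) (≤-reflexive (sym v≈)) })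

  -- The slot matrix and its rounding

  module _ {k : ℕ} (c<s : ∀ i → fromℕ (suc k) ⁻¹ < s i) where

    module _ {v : Carrier} (C : Cover s n v) where
      open Cover C

      -- Row t ≤ n counts the slots for the t largest items; the constant last
      -- row controls the number of patterns.
      entry : ℕ → Fin n → ℕ
      entry t j = if does (t ℕ.≤? n) then count (column j) (take t items) else k

      entry-≤ : ∀ {t} → t ℕ.≤ n → ∀ j → entry t j ≡ count (column j) (take t items)
      entry-≤ {t} t≤n j rewrite dec-true (t ℕ.≤? n) t≤n = ≡.refl

      entry-≰ : ∀ {t} → ¬ t ℕ.≤ n → ∀ j → entry t j ≡ k
      entry-≰ {t} t≰n j rewrite dec-false (t ℕ.≤? n) t≰n = ≡.refl

      slots : Matrix R ℕ (suc (suc n)) n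
      slots i = entry (Fin.toℕ i)

      entry-bounded : ∀ t j → entry t j ℕ.≤ k
      entry-bounded t j with t ℕ.≤? n
      ... | yes t≤n = ℕ.≤-trans (ℕ.≤-reflexive (entry-≤ t≤n j))
                        (ℕ.≤-trans (count-take≤ (column j) items t) (count-items≤ c<s (column j) (fits j)))
      ... | no  t≰n = ℕ.≤-reflexive (entry-≰ t≰n j)

      -- A longer prefix contains a shorter one, and the constant row may come last because no
      -- pattern has more than `k` members.
      entry-mono : ∀ {t u} j → t ℕ.≤ u → entry t j ℕ.≤ entry u j
      entry-mono {t} {u} j t≤u with u ℕ.≤? n
      ... | no  u≰n = ℕ.≤-trans (entry-bounded t j) (ℕ.≤-reflexive (≡.sym (entry-≰ u≰n j)))
      ... | yes u≤n = ≡.subst₂ ℕ._≤_ (≡.sym (entry-≤ (ℕ.≤-trans t≤u u≤n) j)) (≡.sym (entry-≤ u≤n j))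
                        (count-take-mono (column j) items t≤u)

      slots-monotone : Monotone R k slots
      slots-monotone = record
        { bounded  = λ i → entry-bounded (Fin.toℕ i)
        ; monotone = entry-mono
        }

      -- Add the covering constraints of the members of `l`, each of which contributes at least 1.
      length≤coverage : ∀ l → fromℕ (length l) ≤ sum {n} (λ j → fromℕ (count (column j) l) * weight j)
      length≤coverage []      = sum-nonNeg {n} (λ j → ≤-reflexive (sym (zeroˡ (weight j))))
      length≤coverage (i ∷ l) = begin
        1# + fromℕ (length l)
          ≤⟨ +-mono-≤ (covers i) (length≤coverage l) ⟩
        sum {n} (λ j → bits R (column j) i * weight j) + sum {n} (λ j → fromℕ (count (column j) l) * weight j)
          ≈⟨ ∑-distrib-+ {n} _ _ ⟨
        sum {n} (λ j → bits R (column j) i * weight j + fromℕ (count (column j) l) * weight j)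
          ≈⟨ sum-cong {n} (λ j → trans (*-congʳ (trans (fromℕ-+ (bit (column j) i) _)
                                                       (+-congʳ (fromℕ-bit (column j) i))))
                                       (distribʳ (weight j) _ _)) ⟨
        sum {n} (λ j → fromℕ (count (column j) (i ∷ l)) * weight j) ∎

      D : Carrier
      D = Dmon R k n

      module Rounded (x : Vec Bool n)
        (near : ∀ i → ∣ _*ᵥ_ R (fromℕᴹ slots) (bits R x) i - _*ᵥ_ R (fromℕᴹ slots) weight i ∣ ≤ D)
        (1≤k : 1 ℕ.≤ k) where

        bins : List Bin
        bins = select x (empty-bin ∘ column)

        S : ℕ → ℕ
        S t = capacity bins (take t items)

        -- Both directions of the error are used: the prefix rows must not lose too many slots, and
        -- the constant row must not gain too many patterns.
        near-row : ∀ {t} → t ℕ.< suc (suc n) →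
                   sum {n} (λ j → fromℕ (entry t j) * weight j)
                     ≤ sum {n} (λ j → fromℕ (entry t j) * bits R x j) + D
                   × sum {n} (λ j → fromℕ (entry t j) * bits R x j)
                     ≤ sum {n} (λ j → fromℕ (entry t j) * weight j) + D
        near-row t< = ≡.subst
          (λ t → sum {n} (λ j → fromℕ (entry t j) * weight j)
                   ≤ sum {n} (λ j → fromℕ (entry t j) * bits R x j) + D
                 × sum {n} (λ j → fromℕ (entry t j) * bits R x j)
                   ≤ sum {n} (λ j → fromℕ (entry t j) * weight j) + D)
          (Fin.toℕ-fromℕ< t<)
          (∣x-y∣≤z⇒y≤x+z (near (Fin.fromℕ< t<)) , ∣x-y∣≤z⇒x≤y+z (near (Fin.fromℕ< t<)))

        0≤D : 0# ≤ D
        0≤D = ≤-trans (0≤∣x∣ (_*ᵥ_ R (fromℕᴹ slots) (bits R x) zero - _*ᵥ_ R (fromℕᴹ slots) weight zero))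
                      (near zero)

        enough-slots : ∀ t → t ℕ.≤ n → fromℕ t ≤ fromℕ (S t) + D
        enough-slots t t≤n = begin
          fromℕ t
            ≡⟨ ≡.cong fromℕ length-take-items ⟨
          fromℕ (length (take t items))
            ≤⟨ length≤coverage (take t items) ⟩
          sum {n} (λ j → fromℕ (count (column j) (take t items)) * weight j)
            ≈⟨ sum-cong {n} (λ j → *-congʳ (reflexive (≡.cong fromℕ (entry-≤ t≤n j)))) ⟨
          sum {n} (λ j → fromℕ (entry t j) * weight j)
            ≤⟨ proj₁ (near-row (s≤s (ℕ.m≤n⇒m≤1+n t≤n))) ⟩
          sum {n} (λ j → fromℕ (entry t j) * bits R x j) + D
            ≈⟨ +-congʳ (sum-cong {n} (λ j → *-congʳ (reflexive (≡.cong fromℕ (entry-≤ t≤n j))))) ⟩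
          sum {n} (λ j → fromℕ (count (column j) (take t items)) * bits R x j) + D
            ≈⟨ +-congʳ (capacity-select {n} x column (take t items)) ⟩
          fromℕ (S t) + D ∎
          where
          length-take-items : length (take t items) ≡ t
          length-take-items = ≡.trans (length-take t items)
            (≡.trans (≡.cong (t ℕ.⊓_) length-items) (ℕ.m≤n⇒m⊓n≡m t≤n))

        -- `suc n` is the row index just beyond all prefixes, where every entry is `k`.
        last-row : ∀ (u : Vector Carrier n) → sum {n} (λ j → fromℕ (entry (suc n) j) * u j) ≈ fromℕ k * sum u
        last-row u = trans
          (sum-cong {n} (λ j → *-congʳ (reflexive (≡.cong fromℕ (entry-≰ ℕ.1+n≰n j)))))
          (sym (*-distribˡ-sum {n} (fromℕ k) u))

        k≉0 : ¬ fromℕ k ≈ 0#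
        k≉0 k≈0 = 1≰0 (≤-trans (≤-reflexive (sym fromℕ1≈1)) (≤-trans (fromℕ-mono-≤ 1≤k) (≤-reflexive k≈0)))

        cancel-k : ∀ z → fromℕ k ⁻¹ * (fromℕ k * z) ≈ z
        cancel-k z = trans (sym (*-assoc _ _ z)) (trans (*-congʳ (⁻¹-inverseˡ k≉0)) (*-identityˡ z))

        bins≤ : fromℕ (length bins) ≤ v + fromℕ k ⁻¹ * D
        bins≤ = begin
          fromℕ (length bins)
            ≈⟨ length-select x (empty-bin ∘ column) ⟩
          sum (bits R x)
            ≈⟨ cancel-k _ ⟨
          fromℕ k ⁻¹ * (fromℕ k * sum (bits R x))
            ≈⟨ *-congˡ (last-row (bits R x)) ⟨
          fromℕ k ⁻¹ * sum {n} (λ j → fromℕ (entry (suc n) j) * bits R x j)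
            ≤⟨ *-monoˡ-≤ (⁻¹-nonNeg (fromℕ-nonNeg k) k≉0) (proj₂ (near-row ℕ.≤-refl)) ⟩
          fromℕ k ⁻¹ * (sum {n} (λ j → fromℕ (entry (suc n) j) * weight j) + D)
            ≈⟨ *-congˡ (+-congʳ (last-row weight)) ⟩
          fromℕ k ⁻¹ * (fromℕ k * sum weight + D)
            ≈⟨ distribˡ _ _ _ ⟩
          fromℕ k ⁻¹ * (fromℕ k * sum weight) + fromℕ k ⁻¹ * D
            ≈⟨ +-congʳ (cancel-k _) ⟩
          sum weight + fromℕ k ⁻¹ * D
            ≤⟨ +-monoˡ-≤ _ cost ⟩
          v + fromℕ k ⁻¹ * D ∎

        budget : ∃[ e ] (∀ t → t ℕ.≤ n → t ℕ.≤ e ℕ.+ S t) × fromℕ e ≤ D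
        budget = shortfall n S 0≤D enough-slots

        bins-fit : All (Fits 1# items) bins
        bins-fit = select⁺ x (λ j → empty-bin-fits (column j) (fits j))

        OPT≤rounded : OPT R s ≤ v + (1# + fromℕ k ⁻¹) * D
        OPT≤rounded with e , enough , e≤D ← budget
                    with m , m≤ , solution ← pack-items {bins} {e} bins-fit enough =
          ≤-trans (OPT≤ solution) (fromℕ-bound {m} {e} {length bins} {v} {D} {fromℕ k ⁻¹} m≤ e≤D bins≤)

      OPT≤cover : 1 ℕ.≤ k → (∀ j → weight j ≤ 1#) → OPT R s ≤ v + (1# + fromℕ k ⁻¹) * D
      OPT≤cover 1≤k w≤1 = Rounded.OPT≤rounded (proj₁ rounding) (proj₂ rounding) 1≤k
        where
        rounding : ∃[ x ] ∀ i → ∣ _*ᵥ_ R (fromℕᴹ slots) (bits R x) i - _*ᵥ_ R (fromℕᴹ slots) weight i ∣ ≤ D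
        rounding = round slots slots-monotone weight (λ j → weight-nonNeg j , w≤1 j)

    OPT≤OPTf : 1 ℕ.≤ k → OPT R s ≤ OPTf R s + (1# + fromℕ k ⁻¹) * Dmon R k n
    -- With the discrepancy term moved to the left, the claim becomes a lower bound on the objective
    -- of every feasible solution, which the infimum inherits.
    OPT≤OPTf 1≤k = ≤-trans (x-y≤z⇒x≤y+z (≤OPTf (λ x feasible →
      let C , w≤1 = clamp s (sparse-cover s (feasible⇒cover s x feasible))
      in x≤y+z⇒x-y≤z (≤-trans (OPT≤cover C 1≤k w≤1) (≤-reflexive (+-comm _ _))))))
      (≤-reflexive (+-comm _ _))

theorem4 : (R : CompleteOrderedField) → let open CompleteOrderedField R in
    (k n : ℕ) → 1 ℕ.≤ k → 1 ℕ.≤ n →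
    (s : Vector Carrier n) →
    (∀ i → (fromℕ (suc k) ⁻¹ < s i) × (s i ≤ 1#)) →
    OPT R s ≤ OPTf R s + (1# + fromℕ k ⁻¹) * Dmon R k n
theorem4 R k n 1≤k 1≤n s sizes =
  Bound.OPT≤OPTf R s 0≤s (proj₂ ∘ sizes) (proj₁ ∘ sizes) 1≤k
  where
  open CompleteOrderedField R
  open OrderedField R using (⁻¹-nonNeg; fromℕ-nonNeg; fromℕ-suc≉0)
  0≤s : ∀ i → 0# ≤ s i
  0≤s i = ≤-trans (⁻¹-nonNeg (fromℕ-nonNeg (suc k)) (fromℕ-suc≉0 k)) (proj₁ (proj₁ (sizes i)))
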